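{- Let $\mathcal{H}_1,\mathcal{H}_2$ be two $\sigma$-MAGs with the same node set $\mathcal{V}$. Then $\mathcal{H}_1$ and $\mathcal{H}_2$ are $m$-Markov equivalent if and only if all of the following three conditions hold: (1) $\mathcal{H}_1,\mathcal{H}_2$ have the same adjacencies. (2) $\mathcal{H}_1,\mathcal{H}_2$ have the same unshielded colliders. (3) Whenever $\pi$ is a discriminating path for a node $v$ in $\mathcal{H}_1$ and the corresponding path $\pi'$ in $\mathcal{H}_2$ (the path with the same sequence of nodes) is also a discriminating path for $v$, then $v$ is a collider on $\pi$ in $\mathcal{H}_1$ if and only if $v$ is a collider on $\pi'$ in $\mathcal{H}_2$.
   Context: **Mixed graphs.** A mixed graph $\mathcal{H}=(\mathcal{V},\mathcal{E})$ has nodes $\mathcal{V}$ and edges between nodes of the types $\rightarrow,\leftarrow,\leftrightarrow,-$ ($a\rightarrow b$ is the same as $b\leftarrow a$; $\leftrightarrow$ and $-$ are symmetric). Each edge has a mark (tail or arrowhead) at each end; $*$ stands for either mark: $a\mathrel{*\!\!\rightarrow} b$ (equivalently $b\mathrel{\leftarrow\!\!*}a$) means $a\rightarrow b$ or $a\leftrightarrow b$ (the edge is into $b$); $a\mathrel{ -\!\!*}b$ means $a\rightarrow b$ or $a-b$ (the edge is out of $a$). Two nodes are adjacent if there is an edge between them. A walk between $v_0$ and $v_n$ ($n\ge 0$) is an alternating sequence $v_0,e_1,v_1,\dots,e_n,v_n$ with $e_i$ an edge between $v_{i-1}$ and $v_i$; it is a path if no node occurs more than once. It is a directed walk (path) from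 $v_0$ to $v_n$ if $e_i$ is $v_{i-1}\rightarrow v_i$ for all $i$, and an anterior walk (path) from $v_0$ to $v_n$ if $e_i$ is $v_{i-1}\mathrel{ -\!\!*}v_i$ for all $i$. $\mathrm{Anc}_{\mathcal H}(b)$ is the set of nodes from which there is a directed walk to $b$ (so $b\in\mathrm{Anc}_{\mathcal H}(b)$), and $\mathrm{Anc}_{\mathcal H}(A)=\bigcup_{v\in A}\mathrm{Anc}_{\mathcal H}(v)$. A non-endpoint $v_k$ of a walk is a collider on it if both adjacent edges on the walk have an arrowhead at $v_k$; all other nodes on the walk, including endpoints, are non-colliders. An inducing path is a path between $v_0$ and $v_n$ on which every non-endpoint node is a collider and belongs to $\mathrm{Anc}_{\mathcal H}(\{v_0,v_n\})$. **$\sigma$-MAG.** A mixed graph $\mathcal H$ is a $\sigma$-MAG if: (1) between any two distinct nodes there is at most one edge, and no node is adjacent to itself; (2) (ancestral) if $\mathcal H$ contains an anterior path from $a$ to $b$, then it contains no edge $a\mathrel{\leftarrow\!\!*}b$; (3a) (maximal) there is no inducing path between any two distinct non-adjacent nodes; (3b) ($\sigma$-complete) if $\mathcal H$ contains $a\mathrel{*\!\!\rightarrow}b$ and $b-c$, then $a$ and $c$ are adjacent; and if moreover $\mathcal H$ contains $b-d$ with $d\ne c$, then $c$ and $d$ are adjacent. **$m$-separation.** A walk (or path) $v_0,\dots,v_n$ ($n\ge0$) in a $\sigma$-MAG $\mathcal H$ is $Z$-$m$-open if (a) no non-collider on it (endpoints included) is in $Z$, (b) all colliders on it are in $\mathrm{Anc}_{\mathcal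 H}(Z)$, and (c) it contains no subwalk of the form $v_{k-1}\mathrel{*\!\!\rightarrow}v_k-v_{k+1}$ or $v_{k-1}-v_k\mathrel{\leftarrow\!\!*}v_{k+1}$; otherwise it is $m$-blocked by $Z$. $X$ is $m$-separated from $Y$ given $Z$ in $\mathcal H$ if every walk in $\mathcal H$ from a node in $X$ to a node in $Y$ is $m$-blocked by $Z$. **$m$-Markov equivalence.** $\mathcal H_1,\mathcal H_2$ with the same nodes $\mathcal V$ are $m$-Markov equivalent if for all $X,Y,Z\subseteq\mathcal V$: $X$ is $m$-separated from $Y$ given $Z$ in $\mathcal H_1$ if and only if this holds in $\mathcal H_2$. **Unshielded colliders, discriminating paths.** A triple of distinct nodes $(a,b,c)$ is unshielded if $b$ is adjacent to both $a$ and $c$ but $a$ is not adjacent to $c$; it is an unshielded collider if in addition $a\mathrel{*\!\!\rightarrow}b\mathrel{\leftarrow\!\!*}c$. A path $\pi=(a,v_0,\dots,v_n,b,c)$ with $n\ge0$ in $\mathcal H$ is a discriminating path for $b$ if $a$ is not adjacent to $c$ in $\mathcal H$, and for each $k=0,\dots,n$, $v_k$ is a collider on $\pi$ and $v_k\rightarrow c$ in $\mathcal H$. -}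

module Defs where

open import Level using (Level; suc; _⊔_)
open import Data.List.Base using (List; []; _∷_; _++_)
open import Data.List.Membership.Propositional using () renaming (_∈_ to _∈ₗ_)
open import Data.List.Relation.Unary.Unique.Propositional using (Unique)
open import Data.Product.Base using (Σ; Σ-syntax; ∃-syntax; _×_; _,_)
open import Data.Sum.Base using (_⊎_)
open import Function.Bundles using (_⇔_)
open import Relation.Binary.Core using (Rel)
open import Relation.Binary.Construct.Closure.ReflexiveTransitive
  using (Star; ε; _◅_)
open import Relation.Binary.Definitions using (Symmetric)
open import Relation.Binary.PropositionalEquality.Core using (_≡_; _≢_)
open import Relation.Nullary.Negation.Core using (¬_)
open import Relation.Unary using (Pred; _∈_; _∉_; _∪_; ｛_｝)

private
  variable
    ℓ t : Level

data Mark : Set where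
  tail arrowhead : Mark

-- The three relations are independent, so that several edges (of different
-- types) may join two nodes.
record MixedGraph (V : Set ℓ) : Set (suc ℓ) where
  infix 4 _⟶_ _⟷_ _──_
  field
    _⟶_ _⟷_ _──_ : Rel V ℓ
    ⟷-sym : Symmetric _⟷_
    ──-sym : Symmetric _──_

-- For T a step relation, Star T a b is the type of T-walks from a to b.
nodes : {V : Set ℓ} {T : Rel V t} {a b : V} → Star T a b → List V
nodes {a = a} ε       = a ∷ []
nodes {a = a} (_ ◅ w) = a ∷ nodes w

IsPath : {V : Set ℓ} {T : Rel V t} {a b : V} → Star T a b → Set ℓ
IsPath w = Unique (nodes w)

-- Consecutive e f w: the edges e , f occur one directly after the other on w.
-- Thus the non-endpoint positions of w correspond to the inhabitants of these
-- types, with the position's node being the common node of e and f.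
data Consecutive {V : Set ℓ} {T : Rel V t} {u v x : V}
                 (e : T u v) (f : T v x) :
                 {a b : V} → Star T a b → Set (ℓ ⊔ t) where
  here  : {b : V} {w : Star T x b} → Consecutive e f (e ◅ f ◅ w)
  there : {a a′ b : V} {g : T a a′} {w : Star T a′ b} →
          Consecutive e f w → Consecutive e f (g ◅ w)

module _ {V : Set ℓ} (H : MixedGraph V) where
  open MixedGraph H

  infix 4 _∗→_ _-∗_

  _∗→_ : Rel V ℓ
  a ∗→ b = a ⟶ b ⊎ a ⟷ b

  _-∗_ : Rel V ℓ
  a -∗ b = a ⟶ b ⊎ a ── b

  data Edge (a b : V) : Set ℓ where
    forward    : a ⟶ b → Edge a b
    backward   : b ⟶ a → Edge a b
    bidirected : a ⟷ b → Edge a b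
    undirected : a ── b → Edge a b

  markˡ markʳ : {a b : V} → Edge a b → Mark
  markˡ (forward _)    = tail
  markˡ (backward _)   = arrowhead
  markˡ (bidirected _) = arrowhead
  markˡ (undirected _) = tail
  markʳ (forward _)    = arrowhead
  markʳ (backward _)   = tail
  markʳ (bidirected _) = arrowhead
  markʳ (undirected _) = tail

  -- Edges are determined by their end nodes and marks: distinct proofs of,
  -- say, a ⟶ b are not regarded as distinct edges.
  SameEdge : {a b : V} → Edge a b → Edge a b → Set
  SameEdge e f = markˡ e ≡ markˡ f × markʳ e ≡ markʳ f

  Adjacent : Rel V ℓ
  Adjacent a b = Edge a b

  Walk : Rel V ℓ
  Walk = Star Edge

  Anc : V → Pred V ℓ
  Anc b a = Star _⟶_ a b

  AncSet : Pred V ℓ → Pred V ℓ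
  AncSet A a = ∃[ v ] v ∈ A × a ∈ Anc v

  AnteriorPath : Rel V ℓ
  AnteriorPath a b = Σ (Star _-∗_ a b) IsPath

  Collide : {u v x : V} → Edge u v → Edge v x → Set
  Collide e f = markʳ e ≡ arrowhead × markˡ f ≡ arrowhead

  -- A node occurring several times on w can be both a collider (at one
  -- position) and a non-collider (at another).
  data ColliderOn {a b : V} (w : Walk a b) (v : V) : Set ℓ where
    collider : {u x : V} {e : Edge u v} {f : Edge v x} →
               Consecutive e f w → Collide e f → ColliderOn w v

  data NonColliderOn {a b : V} (w : Walk a b) : V → Set ℓ where
    start  : NonColliderOn w a
    end    : NonColliderOn w b
    middle : {u v x : V} {e : Edge u v} {f : Edge v x} →
             Consecutive e f w → ¬ Collide e f → NonColliderOn w v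

  IsInducing : {a b : V} → Walk a b → Set ℓ
  IsInducing {a} {b} w =
    IsPath w ×
    (∀ {u v x} {e : Edge u v} {f : Edge v x} → Consecutive e f w →
       Collide e f × v ∈ AncSet (｛ a ｝ ∪ ｛ b ｝))

  record IsσMAG : Set ℓ where
    field
      atMostOneEdge : ∀ {a b} → a ≢ b → (e f : Edge a b) → SameEdge e f
      noSelfLoop    : ∀ {a} → ¬ Adjacent a a
      ancestral     : ∀ {a b} → AnteriorPath a b → ¬ (b ∗→ a)
      maximal       : ∀ {a b} → a ≢ b → ¬ Adjacent a b →
                      ¬ (Σ[ w ∈ Walk a b ] IsInducing w)
      σ-complete₁   : ∀ {a b c} → a ∗→ b → b ── c → Adjacent a c
      σ-complete₂   : ∀ {a b c d} → a ∗→ b → b ── c → b ── d → d ≢ c →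
                      Adjacent c d

  Undirected : {a b : V} → Edge a b → Set
  Undirected e = markˡ e ≡ tail × markʳ e ≡ tail

  -- e , f form  u ∗→ v ── x  or  u ── v ←∗ x.
  Forbidden : {u v x : V} → Edge u v → Edge v x → Set
  Forbidden e f = (markʳ e ≡ arrowhead × Undirected f)
                ⊎ (Undirected e × markˡ f ≡ arrowhead)

  record Open (Z : Pred V ℓ) {a b : V} (w : Walk a b) : Set ℓ where
    field
      nonColliders : ∀ {v} → NonColliderOn w v → v ∉ Z
      colliders    : ∀ {v} → ColliderOn w v → v ∈ AncSet Z
      noForbidden  : ∀ {u v x} {e : Edge u v} {f : Edge v x} →
                     Consecutive e f w → ¬ Forbidden e f

  Blocked : Pred V ℓ → {a b : V} → Walk a b → Set ℓ
  Blocked Z w = ¬ Open Z w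

  Separated : (X Y Z : Pred V ℓ) → Set ℓ
  Separated X Y Z = ∀ {x y} → x ∈ X → y ∈ Y → (w : Walk x y) → Blocked Z w

  Unshielded : (a b c : V) → Set ℓ
  Unshielded a b c = (a ≢ b × b ≢ c × a ≢ c)
                   × Adjacent b a × Adjacent b c × ¬ Adjacent a c

  UnshieldedCollider : (a b c : V) → Set ℓ
  UnshieldedCollider a b c = Unshielded a b c × a ∗→ b × c ∗→ b

  -- The node sequence is (a , v₀ , vs , b , c), where vs lists v₁ , … , vₙ.
  Discriminating : {a c : V} → Walk a c → V → Set ℓ
  Discriminating {a} {c} π b =
    IsPath π × ¬ Adjacent a c ×
    (∃[ v₀ ] ∃[ vs ] nodes π ≡ a ∷ (v₀ ∷ vs) ++ b ∷ c ∷ [] ×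
       (∀ {v} → v ∈ₗ v₀ ∷ vs → ColliderOn π v × v ⟶ c))

module _ {V : Set ℓ} (H₁ H₂ : MixedGraph V) where

  MarkovEquivalent : Set (suc ℓ)
  MarkovEquivalent = (X Y Z : Pred V ℓ) →
                     Separated H₁ X Y Z ⇔ Separated H₂ X Y Z

  SameAdjacencies : Set ℓ
  SameAdjacencies = ∀ a b → Adjacent H₁ a b ⇔ Adjacent H₂ a b

  SameUnshieldedColliders : Set ℓ
  SameUnshieldedColliders = ∀ a b c →
    UnshieldedCollider H₁ a b c ⇔ UnshieldedCollider H₂ a b c

  SameDiscriminatedColliders : Set ℓ
  SameDiscriminatedColliders =
    ∀ {a c} (π : Walk H₁ a c) (π′ : Walk H₂ a c) → nodes π ≡ nodes π′ →
    ∀ v → Discriminating H₁ π v → Discriminating H₂ π′ v →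
    ColliderOn H₁ π v ⇔ ColliderOn H₂ π′ v

{-# OPTIONS --safe #-}
module Submission where

-- If a and b are not adjacent, then Separator.Sep a b, which consists of (almost all)
-- anterior nodes of {a , b}, separates them, because all non-endpoints of a shortest
-- open walk would be colliders and ancestors of {a , b}, contradicting maximality.
-- In an equivalent graph the same set separates a and b; this yields the adjacencies,
-- and it excludes walks from a to b through Sep a b with only colliders in between,
-- which yields the unshielded and the discriminated colliders.
--
-- Conversely, let v be a walk that is open given Z in H₁ and minimizes its length plus
-- the distances of its nodes to Z.  Since no shortcut of v is open, v is a path, and
-- every non-endpoint v p is the middle of an unshielded triple or is discriminated by a
-- segment of v ending with v (suc p), or in the mirrored way.  By induction along these
-- segments v has the same colliders in H₂.  A collider v p that cannot be replaced by
-- the next node d on a shortest directed path to Z is discriminated by a segment of v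
-- followed by d, so that v p ⟶ d in H₂ as well.  Hence v is open in H₂.

open import Defs
open import Axiom.ExcludedMiddle using (ExcludedMiddle)
open import Level using (Level)
open import Data.Empty using (⊥; ⊥-elim)
open import Data.List.Base as List using (List; []; _∷_; _++_; applyUpTo)
open import Data.List.Properties using (∷-injective)
open import Data.List.Membership.Propositional using () renaming (_∈_ to _∈ₗ_)
open import Data.List.Membership.Propositional.Properties using (∈-applyUpTo⁻)
open import Data.List.Relation.Unary.All as All using (All; []; _∷_)
open import Data.List.Relation.Unary.Any using (here; there)
open import Data.List.Relation.Unary.AllPairs using ([]; _∷_)
open import Data.Nat.Base
open import Data.Nat.Induction using (<-rec)
open import Data.Nat.Properties
open import Data.Product.Base using (Σ; Σ-syntax; _×_; _,_; proj₁; proj₂)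
open import Data.Sum.Base using (_⊎_; inj₁; inj₂; swap)
open import Function.Base using (_∘_; id; case_of_)
open import Function.Bundles using (_⇔_; mk⇔; Equivalence)
open import Function.Construct.Symmetry using (⇔-sym)
open import Relation.Binary.Construct.Closure.ReflexiveTransitive
  using (Star; ε; _◅_; _◅◅_; gmap)
open import Relation.Binary.Core using (Rel)
open import Relation.Binary.Definitions using (tri<; tri≈; tri>)
open import Relation.Binary.PropositionalEquality
open import Relation.Nullary using (¬_; yes; no; contradiction)
open import Relation.Unary using (Pred; _∈_; _∉_; _∪_; ｛_｝)

-- Walks are treated as a length together with a function from positions to nodes. Nothing is lost:
-- ancestrality makes the marks of an edge depend on its two nodes only, and openness is a condition
-- on consecutive triples (`OK`). Shortcuts and reversals become operations on functions, and only
-- the triples next to a new edge need checking.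
--
-- Undirected edges are the first obstacle: a shortcut with an arrowhead at a node that is followed
-- by an undirected edge is forbidden. By σ-completeness the arrowhead can be carried along the
-- undirected edges until the walk ends or continues with another type of edge.
--
-- The second obstacle is a circularity. Condition (3) says something only about paths that
-- discriminate in both graphs, so the colliders of a segment and their edges to its last node have
-- to be transferred first. These colliders may in turn be discriminated from the other side;
-- `discriminates-nested` confines such segments to the first one, which makes the induction well
-- founded.

private
  variable
    ℓ ℓ′ : Level

-- Node sequences: joining, reversal, weights

module _ {V : Set ℓ} where

  -- The two pieces are linked by a new edge from `v l` to `w 0`, not glued at a common node.
  join : ℕ → (ℕ → V) → (ℕ → V) → ℕ → V
  join l       v w zero    = v zero
  join zero    v w (suc k) = w k
  join (suc l) v w (suc k) = join l (v ∘ suc) w k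

  join-left : ∀ l {v w k} → k ≤ l → join l v w k ≡ v k
  join-left l       {k = zero}  _         = refl
  join-left (suc l) {k = suc k} (s≤s k≤l) = join-left l k≤l

  join-right : ∀ l {v w} k → join l v w (suc (k + l)) ≡ w k
  join-right zero    k rewrite +-identityʳ k = refl
  join-right (suc l) k rewrite +-suc k l     = join-right l k

  rev : ℕ → (ℕ → V) → ℕ → V
  rev n v i = v (n ∸ i)

  module Weight (f : V → ℕ) where

    weight : ℕ → (ℕ → V) → ℕ
    weight zero    v = suc (f (v zero))
    weight (suc n) v = weight n v + suc (f (v (suc n)))

    weight-cong : ∀ n {v w} → (∀ {k} → k ≤ n → v k ≡ w k) → weight n v ≡ weight n w
    weight-cong zero    eq = cong (suc ∘ f) (eq z≤n)
    weight-cong (suc n) eq =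
      cong₂ _+_ (weight-cong n (λ k≤n → eq (m≤n⇒m≤1+n k≤n))) (cong (suc ∘ f) (eq ≤-refl))

    weight-cons : ∀ n v → weight (suc n) v ≡ suc (f (v zero)) + weight n (v ∘ suc)
    weight-cons zero    v = refl
    weight-cons (suc n) v =
      trans (cong (_+ suc (f (v (suc (suc n))))) (weight-cons n v))
            (+-assoc (suc (f (v zero))) (weight n (v ∘ suc)) _)

    weight-rev : ∀ n v → weight n (rev n v) ≡ weight n v
    weight-rev zero    v = refl
    weight-rev (suc n) v =
      trans (weight-cons n (rev (suc n) v))
     (trans (cong (suc (f (v (suc n))) +_) (weight-rev n v)) (+-comm (suc (f (v (suc n)))) _))

    weight-join : ∀ l m {v w} →
                  weight (suc (m + l)) (join l v w) ≡ weight l v + weight m w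
    weight-join l zero    = cong₂ _+_ (weight-cong l (join-left l)) (cong (suc ∘ f) (join-right l 0))
    weight-join l (suc m) {v} {w} =
      trans (cong₂ _+_ (weight-join l m) (cong (suc ∘ f) (join-right l (suc m))))
            (+-assoc (weight l v) (weight m w) _)

    weight-mono : ∀ {m n} v → m ≤ n → weight m v ≤ weight n v
    weight-mono v m≤n = go v (≤⇒≤′ m≤n)
      where
      go : ∀ {m n} v → m ≤′ n → weight m v ≤ weight n v
      go v (≤′-reflexive refl) = ≤-refl
      go v (≤′-step le)        = ≤-trans (go v le) (m≤m+n _ _)

    weight-prefix< : ∀ {m n} v → m < n → weight m v < weight n v
    weight-prefix< {m} v m<n =
      ≤-trans (≤-trans (≤-reflexive (sym (+-comm (weight m v) 1)))
                       (+-monoʳ-≤ (weight m v) (s≤s z≤n)))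
              (weight-mono v m<n)

    -- A shortcut from `i` to `r` drops all nodes in between. The weight of one of them, `v p`,
    -- stays on the left-hand side: it pays for a replacement node.
    weight-gap : ∀ {i p r} m v → i < p → p < r →
                 weight i v + (suc (f (v p)) + weight m (λ k → v (k + r))) ≤ weight (m + r) v
    weight-gap {i} {suc p} {suc r} zero v (s≤s i≤p) (s≤s p<r) =
      ≤-trans (≤-reflexive (sym (+-assoc (weight i v) _ _)))
        (+-monoˡ-≤ _ (≤-trans (+-monoˡ-≤ _ (weight-mono v i≤p)) (weight-mono v p<r)))
    weight-gap {i} {p} {r} (suc m) v i<p p<r =
      ≤-trans (≤-reflexive (trans (cong (weight i v +_) (sym (+-assoc (suc (f (v p))) w _)))
                                  (sym (+-assoc (weight i v) (suc (f (v p)) + w) _))))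
              (+-monoˡ-≤ _ (weight-gap m v i<p p<r))
      where w = weight m (λ k → v (k + r))

    weight-suffix< : ∀ m {r} v → 0 < r → weight m (λ k → v (k + r)) < weight (m + r) v
    weight-suffix< zero    {suc r} v _ = m<n+m _ {weight r v} (pos r v)
      where
      pos : ∀ r v → 0 < weight r v
      pos zero    v = z<s
      pos (suc r) v = <-≤-trans (pos r v) (m≤m+n _ _)
    weight-suffix< (suc m) v 0<r = +-monoˡ-< _ (weight-suffix< m v 0<r)

-- Positions on walks, and walks along sequences

module _ {V : Set ℓ} {T : Rel V ℓ′} where

  private
    variable
      a b : V

  length : Star T a b → ℕ
  length ε       = 0
  length (_ ◅ w) = suc (length w)

  -- Constant after position length w.
  at : Star T a b → ℕ → V
  at {a = a} w zero    = a
  at {a = a} ε (suc k) = a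
  at (_ ◅ w) (suc k)   = at w k

  at-length : (w : Star T a b) → at w (length w) ≡ b
  at-length ε       = refl
  at-length (_ ◅ w) = at-length w

  step-at : ∀ {k} (w : Star T a b) → k < length w → T (at w k) (at w (suc k))
  step-at {k = zero}  (e ◅ w) _        = e
  step-at {k = suc k} (_ ◅ w) (s≤s lt) = step-at w lt

  nodes-at : (w : Star T a b) → nodes w ≡ applyUpTo (at w) (suc (length w))
  nodes-at ε       = refl
  nodes-at (_ ◅ w) = cong (_ ∷_) (nodes-at w)

  at-∈ : ∀ {k} (w : Star T a b) → k ≤ length w → at w k ∈ₗ nodes w
  at-∈ {k = zero}  ε       _        = here refl
  at-∈ {k = zero}  (_ ◅ w) _        = here refl
  at-∈ {k = suc k} (_ ◅ w) (s≤s le) = there (at-∈ w le)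

  ∈-at : ∀ {x} (w : Star T a b) → x ∈ₗ nodes w → Σ[ k ∈ ℕ ] k ≤ length w × x ≡ at w k
  ∈-at ε       (here refl) = 0 , z≤n , refl
  ∈-at (_ ◅ w) (here refl) = 0 , z≤n , refl
  ∈-at (_ ◅ w) (there x∈w) with ∈-at w x∈w
  ... | k , le , eq = suc k , s≤s le , eq

  path⇒distinct : ∀ {j k} (w : Star T a b) → IsPath w → j < k → k ≤ length w → at w j ≢ at w k
  path⇒distinct {j = zero}  {suc k} (_ ◅ w) (a∉w ∷ _) _ (s≤s le) = All.lookup a∉w (at-∈ w le)
  path⇒distinct {j = suc j} {suc k} (_ ◅ w) (_ ∷ u) (s≤s lt) (s≤s le) = path⇒distinct w u lt le

  distinct⇒path : (w : Star T a b) → (∀ {j k} → j < k → k ≤ length w → at w j ≢ at w k) → IsPath w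
  distinct⇒path ε       _ = [] ∷ []
  distinct⇒path (_ ◅ w) d =
    All.tabulate (λ x∈w eq → case ∈-at w x∈w of λ { (k , le , eq′) → d z<s (s≤s le) (trans eq eq′) })
    ∷ distinct⇒path w (λ lt le → d (s≤s lt) (s≤s le))

  consecutive-at : ∀ {k} (w : Star T a b) → suc k < length w →
    Σ[ e ∈ T (at w k) (at w (suc k)) ] Σ[ f ∈ T (at w (suc k)) (at w (suc (suc k))) ]
      Consecutive e f w
  consecutive-at {k = zero}  (_ ◅ ε) (s≤s ())
  consecutive-at {k = zero}  (e ◅ f ◅ w) _ = e , f , here
  consecutive-at {k = suc k} (_ ◅ w) (s≤s lt) with consecutive-at w lt
  ... | e , f , c = e , f , there c

  at-consecutive : ∀ {u m x} {e : T u m} {f : T m x} (w : Star T a b) → Consecutive e f w →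
    Σ[ k ∈ ℕ ] suc k < length w × u ≡ at w k × m ≡ at w (suc k) × x ≡ at w (suc (suc k))
  at-consecutive (_ ◅ _ ◅ w) here = 0 , s≤s z<s , refl , refl , refl
  at-consecutive (_ ◅ w) (there c) with at-consecutive w c
  ... | k , lt , p , q , r = suc k , s≤s lt , p , q , r

  walkAlong : ∀ n (v : ℕ → V) → (∀ k → k < n → T (v k) (v (suc k))) → Star T (v 0) (v n)
  walkAlong zero    v e = ε
  walkAlong (suc n) v e = e 0 z<s ◅ walkAlong n (v ∘ suc) (λ k → e (suc k) ∘ s≤s)

  length-walkAlong : ∀ n {v e} → length (walkAlong n v e) ≡ n
  length-walkAlong zero    = refl
  length-walkAlong (suc n) = cong suc (length-walkAlong n)

  at-walkAlong : ∀ n {v e k} → k ≤ n → at (walkAlong n v e) k ≡ v k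
  at-walkAlong n       {k = zero}  _        = refl
  at-walkAlong (suc n) {k = suc k} (s≤s le) = at-walkAlong n le

  nodes-walkAlong : ∀ n {v e} → nodes (walkAlong n v e) ≡ applyUpTo v (suc n)
  nodes-walkAlong zero    = refl
  nodes-walkAlong (suc n) = cong (_ ∷_) (nodes-walkAlong n)

  consecutive-walkAlong : ∀ n k {v} {s : ∀ k → k < n → T (v k) (v (suc k))} → suc k < n →
    Σ[ e ∈ T (v k) (v (suc k)) ] Σ[ f ∈ T (v (suc k)) (v (suc (suc k))) ]
      Consecutive e f (walkAlong n v s)
  consecutive-walkAlong (suc zero)    zero    (s≤s ())
  consecutive-walkAlong (suc (suc n)) zero    _        = _ , _ , here
  consecutive-walkAlong (suc n)       (suc k) (s≤s lt) with consecutive-walkAlong n k lt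
  ... | e , f , c = e , f , there c

  walkAlong-consecutive : ∀ n {v} {s : ∀ k → k < n → T (v k) (v (suc k))} {u m x}
    {e : T u m} {f : T m x} → Consecutive e f (walkAlong n v s) →
    Σ[ k ∈ ℕ ] suc k < n × u ≡ v k × m ≡ v (suc k) × x ≡ v (suc (suc k))
  walkAlong-consecutive (suc zero)    (there ())
  walkAlong-consecutive (suc (suc n)) here      = 0 , s≤s z<s , refl , refl , refl
  walkAlong-consecutive (suc (suc n)) {s = s} (there c)
    with walkAlong-consecutive (suc n) {s = λ k → s (suc k) ∘ s≤s} c
  ... | k , lt , p , q , r = suc k , s≤s lt , p , q , r

  walkAlong-path : ∀ n {v} {s : ∀ k → k < n → T (v k) (v (suc k))} →
                   (∀ {j k} → j < k → k ≤ n → v j ≢ v k) → IsPath (walkAlong n v s)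
  walkAlong-path n {v} {s} distinct = distinct⇒path (walkAlong n v s) λ {j} {k} lt le eq →
    let le′ = subst (k ≤_) (length-walkAlong n) le in
    distinct lt le′ (trans (sym (at-walkAlong n (<⇒≤ (<-≤-trans lt le′))))
                           (trans eq (at-walkAlong n le′)))

module _ {V : Set ℓ} (em : ExcludedMiddle ℓ) {T : Rel V ℓ′} where

  cutPath : ∀ {a b x} (w : Star T a b) → IsPath w → x ∈ₗ nodes w → Σ (Star T x b) IsPath
  cutPath ε       u       (here refl) = ε , u
  cutPath (e ◅ w) u       (here refl) = e ◅ w , u
  cutPath (e ◅ w) (_ ∷ u) (there x∈w) = cutPath w u x∈w

  walk⇒path : ∀ {a b} → Star T a b → Σ (Star T a b) IsPath
  walk⇒path ε = ε , [] ∷ []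
  walk⇒path {a} (e ◅ w) with walk⇒path w
  ... | p , u with em {P = a ∈ₗ nodes p}
  ...   | yes a∈p = cutPath p u a∈p
  ...   | no  a∉p = e ◅ p , All.tabulate (λ { x∈p refl → a∉p x∈p }) ∷ u

-- Edge calculus from ancestrality and σ-completeness

module Graph (em : ExcludedMiddle ℓ) {V : Set ℓ} (H : MixedGraph V) (mag : IsσMAG H) where
  open MixedGraph H public
  open IsσMAG mag public

  infix 4 _↦_ _⊸_

  _↦_ _⊸_ Adj : Rel V ℓ
  _↦_ = _∗→_ H
  _⊸_ = _-∗_ H
  Adj = Adjacent H

  Coll : V → V → V → Set ℓ
  Coll a b c = a ↦ b × c ↦ b

  private
    variable
      a b c : V

  ancestralWalk : Star _⊸_ a b → ¬ b ↦ a
  ancestralWalk w = ancestral (walk⇒path em w)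

  ⊸⇒¬↤ : a ⊸ b → ¬ b ↦ a
  ⊸⇒¬↤ e = ancestralWalk (e ◅ ε)

  ⟶⇒¬↤ : a ⟶ b → ¬ b ↦ a
  ⟶⇒¬↤ e = ⊸⇒¬↤ (inj₁ e)

  ──⇒¬↤ : a ── b → ¬ b ↦ a
  ──⇒¬↤ e = ⊸⇒¬↤ (inj₂ e)

  ──⇒¬↦ : a ── b → ¬ a ↦ b
  ──⇒¬↦ e = ──⇒¬↤ (──-sym e)

  Adj-sym : Adj a b → Adj b a
  Adj-sym (forward e)    = backward e
  Adj-sym (backward e)   = forward e
  Adj-sym (bidirected e) = bidirected (⟷-sym e)
  Adj-sym (undirected e) = undirected (──-sym e)

  ↦⇒Adj : a ↦ b → Adj a b
  ↦⇒Adj (inj₁ e) = forward e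
  ↦⇒Adj (inj₂ e) = bidirected e

  ↦⇒≢ : a ↦ b → a ≢ b
  ↦⇒≢ e refl = noSelfLoop (↦⇒Adj e)

  markAt : Adj a b → a ↦ b ⊎ b ⊸ a
  markAt (forward e)    = inj₁ (inj₁ e)
  markAt (backward e)   = inj₂ (inj₁ e)
  markAt (bidirected e) = inj₁ (inj₂ e)
  markAt (undirected e) = inj₂ (inj₂ (──-sym e))

  -- σ-completeness provides an edge between `a` and `c`; each type other than `a ⟶ c` would close
  -- an anterior cycle that contains an arrowhead.
  ⟶-── : a ⟶ b → b ── c → a ⟶ c
  ⟶-── e f with σ-complete₁ (inj₁ e) f
  ... | forward g    = g
  ... | backward g   = contradiction (inj₁ e) (ancestralWalk (inj₂ f ◅ inj₁ g ◅ ε))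
  ... | bidirected g = contradiction (inj₂ (⟷-sym g)) (ancestralWalk (inj₁ e ◅ inj₂ f ◅ ε))
  ... | undirected g = contradiction (inj₁ e) (ancestralWalk (inj₂ f ◅ inj₂ (──-sym g) ◅ ε))

  ⟷-── : a ⟷ b → b ── c → a ⟷ c
  ⟷-── e f with σ-complete₁ (inj₂ e) f
  ... | forward g    = contradiction (inj₂ (⟷-sym e)) (ancestralWalk (inj₁ g ◅ inj₂ (──-sym f) ◅ ε))
  ... | backward g   = contradiction (inj₂ e) (ancestralWalk (inj₂ f ◅ inj₁ g ◅ ε))
  ... | bidirected g = g
  ... | undirected g = contradiction (inj₂ e) (ancestralWalk (inj₂ f ◅ inj₂ (──-sym g) ◅ ε))

  ↦-── : a ↦ b → b ── c → a ↦ c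
  ↦-── (inj₁ e) f = inj₁ (⟶-── e f)
  ↦-── (inj₂ e) f = inj₂ (⟷-── e f)

  ↦-⟶ : a ↦ b → b ⟶ c → Adj a c → a ↦ c
  ↦-⟶ e f (forward g)    = inj₁ g
  ↦-⟶ e f (backward g)   = contradiction e (ancestralWalk (inj₁ f ◅ inj₁ g ◅ ε))
  ↦-⟶ e f (bidirected g) = inj₂ g
  ↦-⟶ e f (undirected g) = contradiction e (ancestralWalk (inj₁ f ◅ inj₂ (──-sym g) ◅ ε))

  ⟶-⟶ : a ⟶ b → b ⟶ c → Adj a c → a ⟶ c
  ⟶-⟶ e f g with ↦-⟶ (inj₁ e) f g
  ... | inj₁ h = h
  ... | inj₂ h = contradiction (inj₂ (⟷-sym h)) (ancestralWalk (inj₁ e ◅ inj₁ f ◅ ε))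

  ──-⟶ : a ── b → b ⟶ c → Adj a c → a ⟶ c
  ──-⟶ e f (forward g)    = g
  ──-⟶ e f (backward g)   = contradiction (inj₁ f) (ancestralWalk (inj₁ g ◅ inj₂ e ◅ ε))
  ──-⟶ e f (bidirected g) = contradiction (inj₂ (⟷-sym g)) (ancestralWalk (inj₂ e ◅ inj₁ f ◅ ε))
  ──-⟶ e f (undirected g) = contradiction (inj₁ f) (ancestralWalk (inj₂ (──-sym g) ◅ inj₂ e ◅ ε))

  markʳ⇒↦ : (e : Adj a b) → markʳ H e ≡ arrowhead → a ↦ b
  markʳ⇒↦ (forward e)    _ = inj₁ e
  markʳ⇒↦ (bidirected e) _ = inj₂ e

  markˡ⇒↤ : (e : Adj a b) → markˡ H e ≡ arrowhead → b ↦ a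
  markˡ⇒↤ (backward e)   _ = inj₁ e
  markˡ⇒↤ (bidirected e) _ = inj₂ (⟷-sym e)

  ↦⇒markʳ : a ↦ b → (e : Adj a b) → markʳ H e ≡ arrowhead
  ↦⇒markʳ f (forward e)    = refl
  ↦⇒markʳ f (backward e)   = contradiction f (⟶⇒¬↤ e)
  ↦⇒markʳ f (bidirected e) = refl
  ↦⇒markʳ f (undirected e) = contradiction f (──⇒¬↦ e)

  ↤⇒markˡ : b ↦ a → (e : Adj a b) → markˡ H e ≡ arrowhead
  ↤⇒markˡ f (forward e)    = contradiction f (⟶⇒¬↤ e)
  ↤⇒markˡ f (backward e)   = refl
  ↤⇒markˡ f (bidirected e) = refl
  ↤⇒markˡ f (undirected e) = contradiction f (──⇒¬↤ e)

  Undirected⇒── : (e : Adj a b) → Undirected H e → a ── b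
  Undirected⇒── (undirected e) _ = e

  ──⇒Undirected : a ── b → (e : Adj a b) → Undirected H e
  ──⇒Undirected f (forward e)    = contradiction (inj₁ e) (──⇒¬↦ f)
  ──⇒Undirected f (backward e)   = contradiction (inj₁ e) (──⇒¬↤ f)
  ──⇒Undirected f (bidirected e) = contradiction (inj₂ e) (──⇒¬↦ f)
  ──⇒Undirected f (undirected e) = refl , refl

  Collide⇒Coll : {e : Adj a b} {f : Adj b c} → Collide H e f → Coll a b c
  Collide⇒Coll {e = e} {f} (p , q) = markʳ⇒↦ e p , markˡ⇒↤ f q

  Coll⇒Collide : (e : Adj a b) (f : Adj b c) → Coll a b c → Collide H e f
  Coll⇒Collide e f (p , q) = ↦⇒markʳ p e , ↤⇒markˡ q f

  ColliderOn⇒Coll : ∀ {x} (w : Walk H a b) → ColliderOn H w x →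
                    Σ[ k ∈ ℕ ] suc k < length w × x ≡ at w (suc k)
                      × Coll (at w k) (at w (suc k)) (at w (suc (suc k)))
  ColliderOn⇒Coll w (collider c p) with at-consecutive w c
  ... | k , lt , refl , refl , refl = k , lt , refl , Collide⇒Coll p

  Coll⇒ColliderOn : ∀ {k} (w : Walk H a b) → suc k < length w →
                    Coll (at w k) (at w (suc k)) (at w (suc (suc k))) → ColliderOn H w (at w (suc k))
  Coll⇒ColliderOn w lt p with consecutive-at w lt
  ... | e , f , c = collider c (Coll⇒Collide e f p)

  no-inducing : ∀ n {v : ℕ → V} → (∀ k → k < n → Adj (v k) (v (suc k))) →
                (∀ {j k} → j < k → k ≤ n → v j ≢ v k) → 0 < n → ¬ Adj (v 0) (v n) →
                (∀ {k} → suc k < n → Coll (v k) (v (suc k)) (v (suc (suc k)))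
                                   × v (suc k) ∈ AncSet H (｛ v 0 ｝ ∪ ｛ v n ｝)) → ⊥
  no-inducing n {v} adj distinct 0<n ¬adj colliders =
    maximal (distinct 0<n ≤-refl) ¬adj (walkAlong n v adj , walkAlong-path n distinct , colliders′)
    where
    colliders′ : ∀ {u m x} {e : Adj u m} {f : Adj m x} → Consecutive e f (walkAlong n v adj) →
                 Collide H e f × m ∈ AncSet H (｛ v 0 ｝ ∪ ｛ v n ｝)
    colliders′ {e = e} {f} c with walkAlong-consecutive n c
    ... | k , lt , refl , refl , refl =
      Coll⇒Collide e f (proj₁ (colliders lt)) , proj₂ (colliders lt)

  -- The form with `pred` also applies to reversed positions `n ∸ suc k`, which are not visibly
  -- successors.
  CollAt : (ℕ → V) → ℕ → Set ℓ
  CollAt v p = Coll (v (pred p)) (v p) (v (suc p))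

  CollAt⇒ColliderOn : ∀ n {k v s} → suc k < n → CollAt v (suc k) →
                      ColliderOn H (walkAlong n v s) (v (suc k))
  CollAt⇒ColliderOn n {k} lt p with consecutive-walkAlong n k lt
  ... | e , f , c = collider c (Coll⇒Collide e f p)

  ColliderOn⇒CollAt : ∀ n {k v s} → (∀ {j k} → j < k → k ≤ n → v j ≢ v k) → suc k < n →
                      ColliderOn H (walkAlong n v s) (v (suc k)) → CollAt v (suc k)
  ColliderOn⇒CollAt n {k} {v} distinct lt (collider {e = e} {f} c p) =
    go (walkAlong-consecutive n c) refl (Collide⇒Coll p)
    where
    go : ∀ {u m x} → Σ[ j ∈ ℕ ] suc j < n × u ≡ v j × m ≡ v (suc j) × x ≡ v (suc (suc j)) →
         m ≡ v (suc k) → Coll u m x → CollAt v (suc k)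
    go (j , lt′ , refl , refl , refl) eq p with <-cmp (suc j) (suc k)
    ... | tri≈ _ refl _ = p
    ... | tri< j<k _ _ = contradiction eq (distinct j<k (<⇒≤ lt))
    ... | tri> _ _ k<j = contradiction (sym eq) (distinct k<j (<⇒≤ lt′))

  path-CollAt : ∀ {k} (w : Walk H a b) → IsPath w → suc k < length w →
                ColliderOn H w (at w (suc k)) → CollAt (at w) (suc k)
  path-CollAt {k = k} w path lt p with ColliderOn⇒Coll w p
  ... | j , lt′ , eq , c with <-cmp (suc j) (suc k)
  ...   | tri≈ _ refl _ = c
  ...   | tri< j<k _ _ = contradiction (sym eq) (path⇒distinct w path j<k (<⇒≤ lt))
  ...   | tri> _ _ k<j = contradiction eq (path⇒distinct w path k<j (<⇒≤ lt′))

  -- v l , … , v p , v (suc p) is a discriminating path for v p, or an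
  -- unshielded triple when p = suc l.
  record Discriminates (v : ℕ → V) (p l : ℕ) : Set ℓ where
    field
      l<p     : l < p
      nonadj  : ¬ Adj (v l) (v (suc p))
      between : ∀ {q} → l < q → q < p → CollAt v q × v q ⟶ v (suc p)

-- Open walks as sequences with conditions on triples

module Sequences (em : ExcludedMiddle ℓ) {V : Set ℓ} (H : MixedGraph V) (mag : IsσMAG H)
                 (Z : Pred V ℓ) where
  open Graph em H mag public

  AncZ : Pred V ℓ
  AncZ = AncSet H Z

  -- Openness at the middle node of a triple. `outˡ` and `outʳ` together express that a non-collider
  -- avoids `Z`.
  record OK (a b c : V) : Set ℓ where
    field
      coll  : a ↦ b → c ↦ b → b ∈ AncZ
      outˡ  : b ⊸ a → b ∉ Z
      outʳ  : b ⊸ c → b ∉ Z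
      forbʳ : a ↦ b → ¬ b ── c
      forbˡ : c ↦ b → ¬ b ── a
  open OK public

  private
    variable
      a b c d x y : V
      m n : ℕ
      v w : ℕ → V

  OK-sym : OK a b c → OK c b a
  OK-sym o = record { coll = λ p q → coll o q p ; outˡ = outʳ o ; outʳ = outˡ o
                    ; forbʳ = forbˡ o ; forbˡ = forbʳ o }

  OK-cong : (d ↦ b → c ↦ b) → (b ⊸ d → b ⊸ c) → (b ── d → b ── c) → OK a b c → OK a b d
  OK-cong f g h o = record { coll = λ p q → coll o p (f q) ; outˡ = outˡ o ; outʳ = outʳ o ∘ g
                           ; forbʳ = λ p → forbʳ o p ∘ h ; forbˡ = forbˡ o ∘ f }

  OK-⟶ : b ⟶ c → b ⟶ d → OK a b c → OK a b d
  OK-⟶ e f = OK-cong (λ g → contradiction g (⟶⇒¬↤ f)) (λ _ → inj₁ e)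
                     (λ g → contradiction (inj₁ f) (──⇒¬↦ g))

  OK-⟷ : b ⟷ c → b ⟷ d → OK a b c → OK a b d
  OK-⟷ e f = OK-cong (λ _ → inj₂ (⟷-sym e)) (λ g → contradiction (inj₂ (⟷-sym f)) (⊸⇒¬↤ g))
                     (λ g → contradiction (inj₂ f) (──⇒¬↦ g))

  OK-out : b ⟶ d → b ∉ Z → OK a b d
  OK-out e b∉Z = record
    { coll = λ _ f → contradiction f (⟶⇒¬↤ e) ; outˡ = λ _ → b∉Z ; outʳ = λ _ → b∉Z
    ; forbʳ = λ _ f → ──⇒¬↦ f (inj₁ e) ; forbˡ = λ f → contradiction f (⟶⇒¬↤ e) }

  OK-in : d ↦ b → (a ↦ b → b ∈ AncZ) → (b ⟶ a → b ∉ Z) → ¬ b ── a → OK a b d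
  OK-in e p q r = record
    { coll = λ f _ → p f
    ; outˡ = λ { (inj₁ f) → q f ; (inj₂ f) → contradiction f r }
    ; outʳ = λ f → contradiction e (⊸⇒¬↤ f)
    ; forbʳ = λ _ f → ──⇒¬↤ f e ; forbˡ = λ _ → r }

  OK-undirected : b ── d → b ∉ Z → ¬ a ↦ b → OK a b d
  OK-undirected e b∉Z r = record
    { coll = λ f → contradiction f r ; outˡ = λ _ → b∉Z ; outʳ = λ _ → b∉Z
    ; forbʳ = λ f → contradiction f r ; forbˡ = λ f → contradiction f (──⇒¬↤ e) }

  record Inner (n : ℕ) (v : ℕ → V) : Set ℓ where
    field
      adj : ∀ {k} → k < n → Adj (v k) (v (suc k))
      ok  : ∀ {k} → suc k < n → OK (v k) (v (suc k)) (v (suc (suc k)))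
  open Inner public

  inner-cons : Adj (v 0) (v 1) → (0 < n → OK (v 0) (v 1) (v 2)) → Inner n (v ∘ suc) →
               Inner (suc n) v
  inner-cons e o I = record
    { adj = λ { {zero} _ → e ; {suc k} (s≤s k<n) → adj I k<n }
    ; ok  = λ { {zero} (s≤s 0<n) → o 0<n ; {suc k} (s≤s k<n) → ok I k<n } }

  inner-tail : Inner (suc n) v → Inner n (v ∘ suc)
  inner-tail I = record { adj = adj I ∘ s≤s ; ok = ok I ∘ s≤s }

  inner-prefix : m ≤ n → Inner n v → Inner m v
  inner-prefix m≤n I = record { adj = λ lt → adj I (<-≤-trans lt m≤n)
                              ; ok  = λ lt → ok I (<-≤-trans lt m≤n) }

  inner-suffix : ∀ m j → Inner (m + j) v → Inner m (λ k → v (k + j))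
  inner-suffix m j I = record { adj = λ lt → adj I (+-monoˡ-< j lt)
                              ; ok  = λ lt → ok I (+-monoˡ-< j lt) }

  inner-join : ∀ l → Inner l v → Inner m w → Adj (v l) (w 0) →
               (∀ {h} → l ≡ suc h → OK (v h) (v l) (w 0)) →
               (0 < m → OK (v l) (w 0) (w 1)) → Inner (suc (l + m)) (join l v w)
  inner-join zero          I J e p q = inner-cons e q J
  inner-join (suc zero)    I J e p q =
    inner-cons (adj I z<s) (λ _ → p refl) (inner-join zero (inner-tail I) J e (λ ()) q)
  inner-join (suc (suc l)) I J e p q =
    inner-cons (adj I z<s) (λ _ → ok I (s≤s z<s))
               (inner-join (suc l) (inner-tail I) J e (λ { refl → p refl }) q)

  inner-rev : Inner n v → Inner n (rev n v)
  inner-rev {v = v} I = record { adj = adj′ I ; ok = ok′ I }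
    where
    adj′ : ∀ {n} → Inner n v → ∀ {k} → k < n → Adj (rev n v k) (rev n v (suc k))
    adj′ {suc n} I {k} (s≤s k≤n) rewrite +-∸-assoc 1 k≤n = Adj-sym (adj I (s≤s (m∸n≤m n k)))
    ok′ : ∀ {n} → Inner n v → ∀ {k} → suc k < n →
          OK (rev n v k) (rev n v (suc k)) (rev n v (suc (suc k)))
    ok′ {suc (suc n)} I {k} (s≤s (s≤s k≤n)) rewrite +-∸-assoc 2 k≤n | +-∸-assoc 1 k≤n =
      OK-sym (ok I (s≤s (s≤s (m∸n≤m n k))))

  record OpenSeq (x y : V) (n : ℕ) (v : ℕ → V) : Set ℓ where
    field
      inner  : Inner n v
      start≡ : v 0 ≡ x
      end≡   : v n ≡ y
      x∉Z    : x ∉ Z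
      y∉Z    : y ∉ Z

  openSeq-rev : OpenSeq x y n v → OpenSeq y x n (rev n v)
  openSeq-rev {n = n} {v} O = record
    { inner = inner-rev inner ; start≡ = end≡ ; end≡ = trans (cong v (n∸n≡0 n)) start≡
    ; x∉Z = y∉Z ; y∉Z = x∉Z }
    where open OpenSeq O

  Open⇒OpenSeq : (w : Walk H a b) → Open H Z w → OpenSeq a b (length w) (at w)
  Open⇒OpenSeq w o = record
    { inner = record { adj = step-at w ; ok = ok′ } ; start≡ = refl ; end≡ = at-length w
    ; x∉Z = nonColliders start ; y∉Z = nonColliders end }
    where
    open Open o
    ok′ : ∀ {k} → suc k < length w → OK (at w k) (at w (suc k)) (at w (suc (suc k)))
    ok′ lt with consecutive-at w lt
    ... | e , f , c = record
      { coll  = λ p q → colliders (collider c (Coll⇒Collide e f (p , q)))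
      ; outˡ  = λ p → nonColliders (middle c (λ q → ⊸⇒¬↤ p (markʳ⇒↦ e (proj₁ q))))
      ; outʳ  = λ p → nonColliders (middle c (λ q → ⊸⇒¬↤ p (markˡ⇒↤ f (proj₂ q))))
      ; forbʳ = λ p q → noForbidden c (inj₁ (↦⇒markʳ p e , ──⇒Undirected q f))
      ; forbˡ = λ p q → noForbidden c (inj₂ (──⇒Undirected (──-sym q) e , ↤⇒markˡ p f)) }

  Inner⇒Open : (w : Walk H a b) → Inner (length w) (at w) → a ∉ Z → b ∉ Z → Open H Z w
  Inner⇒Open {a} {b} w I a∉Z b∉Z = record
    { nonColliders = nonColl ; colliders = coll′ ; noForbidden = noForb }
    where
    nonColl : ∀ {x} → NonColliderOn H w x → x ∉ Z
    nonColl start = a∉Z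
    nonColl end   = b∉Z
    nonColl (middle {e = e} {f} c ¬p) with at-consecutive w c
    ... | k , lt , refl , refl , refl with markAt e | markAt (Adj-sym f)
    ...   | inj₂ g | _      = outˡ (ok I lt) g
    ...   | inj₁ _ | inj₂ g = outʳ (ok I lt) g
    ...   | inj₁ g | inj₁ h = contradiction (Coll⇒Collide e f (g , h)) ¬p
    coll′ : ∀ {x} → ColliderOn H w x → x ∈ AncZ
    coll′ p with ColliderOn⇒Coll w p
    ... | k , lt , refl , p , q = coll (ok I lt) p q
    noForb : ∀ {u m x} {e : Adj u m} {f : Adj m x} → Consecutive e f w → ¬ Forbidden H e f
    noForb {e = e} {f} c with at-consecutive w c
    ... | k , lt , refl , refl , refl = λ
      { (inj₁ (p , q)) → forbʳ (ok I lt) (markʳ⇒↦ e p) (Undirected⇒── f q)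
      ; (inj₂ (p , q)) → forbˡ (ok I lt) (markˡ⇒↤ f q) (──-sym (Undirected⇒── e p)) }

  inner-cong : (∀ {k} → k ≤ n → v k ≡ w k) → Inner n v → Inner n w
  inner-cong eq I = record
    { adj = λ lt → subst₂ Adj (eq (<⇒≤ lt)) (eq lt) (adj I lt)
    ; ok  = λ {k} lt → subst₂ (λ P c → P c) (cong₂ OK (eq (<⇒≤ (<-trans (n<1+n k) lt))) (eq (<⇒≤ lt)))
                              (eq lt) (ok I lt) }

  OpenSeq⇒Open : OpenSeq x y n v → Σ[ π ∈ Walk H x y ] Open H Z π
  OpenSeq⇒Open {n = n} {v} O with OpenSeq.start≡ O | OpenSeq.end≡ O
  ... | refl | refl = π , Inner⇒Open π I x∉Z y∉Z
    where
    open OpenSeq O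
    π = walkAlong n v (λ _ → adj inner)
    I : Inner (length π) (at π)
    I = subst (λ k → Inner k (at π)) (sym (length-walkAlong n))
              (inner-cong (λ le → sym (at-walkAlong n le)) inner)

  -- Minimal open walks and their shortcuts

  module Minimality (f : V → ℕ) where
    open Weight f public

    -- f will be the distance to Z: a walk can then be improved either by a shortcut or
    -- by moving a collider closer to Z.
    record Minimal (x y : V) (n : ℕ) (v : ℕ → V) : Set ℓ where
      field
        open-seq : OpenSeq x y n v
        minimal  : ∀ {m w} → OpenSeq x y m w → ¬ weight m w < weight n v
      open OpenSeq open-seq public

    minimal-rev : Minimal x y n v → Minimal y x n (rev n v)
    minimal-rev {n = n} {v} M = record
      { open-seq = openSeq-rev open-seq
      ; minimal  = λ {m} {w} O lt →
          minimal (openSeq-rev O) (subst₂ _<_ (sym (weight-rev m w)) (weight-rev n v) lt) }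
      where open Minimal M

    minimize : OpenSeq x y n v → Σ[ m ∈ ℕ ] Σ[ w ∈ (ℕ → V) ] Minimal x y m w
    minimize {x} {y} {n} {v} O = <-rec P step (weight n v) O refl
      where
      P : ℕ → Set ℓ
      P k = ∀ {n v} → OpenSeq x y n v → weight n v ≡ k → Σ[ m ∈ ℕ ] Σ[ w ∈ (ℕ → V) ] Minimal x y m w
      step : ∀ k → (∀ {j} → j < k → P j) → P k
      step _ rec {n} {v} O refl
        with em {P = Σ[ m ∈ ℕ ] Σ[ w ∈ (ℕ → V) ] OpenSeq x y m w × weight m w < weight n v}
      ... | yes (m , w , O′ , lt) = rec lt O′ refl
      ... | no  none = n , v , record { open-seq = O ; minimal = λ O′ lt → none (_ , _ , O′ , lt) }

    module Shortcuts {x y : V} {n : ℕ} {v : ℕ → V} (M : Minimal x y n v) where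
      open Minimal M public

      v₀∉Z : v 0 ∉ Z
      v₀∉Z rewrite start≡ = x∉Z

      vₙ∉Z : v n ∉ Z
      vₙ∉Z rewrite end≡ = y∉Z

      LeftOK : ℕ → V → Set ℓ
      LeftOK i d = ∀ {h} → i ≡ suc h → OK (v h) (v i) d

      RightOK : V → ℕ → Set ℓ
      RightOK d j = j < n → OK d (v j) (v (suc j))

      suffix : ∀ {j} → j ≤ n → Inner (n ∸ j) (λ k → v (k + j))
      suffix {j} j≤n = inner-suffix (n ∸ j) j (subst (λ n → Inner n v) (sym (m∸n+n≡m j≤n)) inner)

      no-join : ∀ {i m w} → i ≤ n → Inner m w → w m ≡ v n → Adj (v i) (w 0) →
                LeftOK i (w 0) → (0 < m → OK (v i) (w 0) (w 1)) →
                ¬ weight i v + weight m w < weight n v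
      no-join {i} {m} {w} i≤n J w≡ e p q lt = minimal
        (record { inner  = subst (λ k → Inner (suc k) (join i v w)) (+-comm i m)
                                 (inner-join i (inner-prefix i≤n inner) J e p q)
                ; start≡ = start≡
                ; end≡   = trans (join-right i m) (trans w≡ end≡)
                ; x∉Z = x∉Z ; y∉Z = y∉Z })
        (subst (_< weight n v) (sym (weight-join i m)) lt)

      gap : ∀ {i p r} → i < p → p < r → r ≤ n →
            weight i v + (suc (f (v p)) + weight (n ∸ r) (λ k → v (k + r))) ≤ weight n v
      gap {i} {p} {r} i<p p<r r≤n =
        subst (λ k → weight i v + (suc (f (v p)) + weight (n ∸ r) (λ k → v (k + r))) ≤ weight k v)
              (m∸n+n≡m r≤n) (weight-gap (n ∸ r) v i<p p<r)

      bridge : ∀ {i j} → suc i < j → j ≤ n → Adj (v i) (v j) →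
               LeftOK i (v j) → RightOK (v i) j → ⊥
      bridge {i} {j} i<j j≤n e p q =
        no-join (<⇒≤ (<-≤-trans (<-trans (n<1+n i) i<j) j≤n)) (suffix j≤n) (cong v (m∸n+n≡m j≤n)) e p
          (λ 0<n∸j → q (m∸n≢0⇒n<m (>⇒≢ 0<n∸j)))
          (<-≤-trans (+-monoʳ-< (weight i v) (m<n+m _ z<s)) (gap ≤-refl i<j j≤n))

      -- What the old neighbour of a node must satisfy when the new edge on the other side has an
      -- arrowhead at this node. The case of an undirected old edge is left out; `skipˡ` and `skipʳ`
      -- remove it.
      InLeft InRight : ℕ → Set ℓ
      InLeft  i = ∀ {h} → i ≡ suc h → (v h ↦ v i → v i ∈ AncZ) × (v i ⟶ v h → v i ∉ Z)
      InRight j = j < n → (v (suc j) ↦ v j → v j ∈ AncZ) × (v j ⟶ v (suc j) → v j ∉ Z)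

      -- Arrowheads at v j pass on along undirected edges v j ── v (suc j), so that a
      -- shortcut whose end would be forbidden can be continued.
      Passes : V → V → Set ℓ
      Passes b c = ∀ {a} → (a ⟶ b → a ⟶ c) × (a ⟷ b → a ⟷ c)

      Unskippableˡ Unskippableʳ : ℕ → Set ℓ
      Unskippableˡ i = ∀ {a} → a ↦ v i → LeftOK i a
      Unskippableʳ j = ∀ {a} → a ↦ v j → RightOK a j

      skipʳ : ∀ {j} → j ≤ n → InRight j →
              Σ[ k ∈ ℕ ] j ≤ k × k ≤ n × Unskippableʳ k × Passes (v j) (v k)
      skipʳ {j} j≤n = go (n ∸ j) (m∸n+n≡m j≤n)
        where
        go : ∀ m {j} → m + j ≡ n → InRight j →
             Σ[ k ∈ ℕ ] j ≤ k × k ≤ n × Unskippableʳ k × Passes (v j) (v k)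
        go zero    refl r = _ , ≤-refl , ≤-refl , (λ _ lt → contradiction lt (<-irrefl refl)) , id , id
        go (suc m) {j} eq r with em {P = v j ── v (suc j)}
        ... | no  ¬u = _ , ≤-refl , <⇒≤ j<n ,
                       (λ e _ → OK-sym (OK-in e (proj₁ (r j<n)) (proj₂ (r j<n)) ¬u)) , id , id
          where
          j<n : j < n
          j<n = subst (j <_) eq (s≤s (m≤n+m j m))
        -- The condition renews itself: after an undirected edge an arrowhead from the right is
        -- forbidden, and a tail towards the right keeps the node out of `Z`.
        ... | yes u with go m (trans (+-suc m j) eq) (λ lt →
                           (λ f → contradiction (──-sym u) (forbˡ (ok inner lt) f)) ,
                           (λ f → outʳ (ok inner lt) (inj₁ f)))
        ...   | k , le , k≤n , unsk , pass =
          k , <⇒≤ le , k≤n , unsk , proj₁ pass ∘ (λ e → ⟶-── e u) , proj₂ pass ∘ (λ e → ⟷-── e u)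

      skipˡ : ∀ {i} → i ≤ n → InLeft i →
              Σ[ k ∈ ℕ ] k ≤ i × Unskippableˡ k × Passes (v i) (v k)
      skipˡ {zero}  _   l = _ , ≤-refl , (λ _ ()) , id , id
      skipˡ {suc i} i<n l with em {P = v (suc i) ── v i}
      ... | no  ¬u = _ , ≤-refl ,
                     (λ { e refl → OK-in e (proj₁ (l refl)) (proj₂ (l refl)) ¬u }) , id , id
      ... | yes u with skipˡ (<⇒≤ i<n) (λ { refl →
                         (λ f → contradiction (──-sym u) (forbʳ (ok inner i<n) f)) ,
                         (λ f → outˡ (ok inner i<n) (inj₁ f)) })
      ...   | k , le , unsk , pass =
        k , m≤n⇒m≤1+n le , unsk , proj₁ pass ∘ (λ e → ⟶-── e u) , proj₂ pass ∘ (λ e → ⟷-── e u)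

      bridge⟶ : ∀ {i j} → suc i < j → j ≤ n → v i ⟶ v j → v i ∉ Z → InRight j → ⊥
      bridge⟶ i<j j≤n e i∉Z r with skipʳ j≤n r
      ... | k , j≤k , k≤n , unsk , pass =
        bridge (<-≤-trans i<j j≤k) k≤n (forward e′) (λ { refl → OK-out e′ i∉Z }) (unsk (inj₁ e′))
        where e′ = proj₁ pass e

      bridge⟵ : ∀ {i j} → suc i < j → j ≤ n → v j ⟶ v i → v j ∉ Z → InLeft i → ⊥
      bridge⟵ i<j j≤n e j∉Z l with skipˡ (<⇒≤ (<-≤-trans (<-trans (n<1+n _) i<j) j≤n)) l
      ... | k , k≤i , unsk , pass =
        bridge (≤-<-trans (s≤s k≤i) i<j) j≤n (backward e′) (unsk (inj₁ e′))
               (λ _ → OK-sym (OK-out e′ j∉Z))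
        where e′ = proj₁ pass e

      bridge⟷ : ∀ {i j} → suc i < j → j ≤ n → v i ⟷ v j → InLeft i → InRight j → ⊥
      bridge⟷ i<j j≤n e l r
        with skipʳ j≤n r | skipˡ (<⇒≤ (<-≤-trans (<-trans (n<1+n _) i<j) j≤n)) l
      ... | k , j≤k , k≤n , unskʳ , passʳ | h , h≤i , unskˡ , passˡ =
        bridge (<-≤-trans (≤-<-trans (s≤s h≤i) i<j) j≤k) k≤n (bidirected (⟷-sym e′))
               (unskˡ (inj₂ e′)) (unskʳ (inj₂ (⟷-sym e′)))
        where e′ = proj₂ passˡ (⟷-sym (proj₂ passʳ e))

      bridge── : ∀ {i j} → suc i < j → j ≤ n → v i ── v j → v i ∉ Z → v j ∉ Z →
                 (∀ {h} → i ≡ suc h → ¬ v h ↦ v i) → (j < n → ¬ v (suc j) ↦ v j) → ⊥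
      bridge── i<j j≤n e i∉Z j∉Z l r =
        bridge i<j j≤n (undirected e) (λ { refl → OK-undirected e i∉Z (l refl) })
               (λ lt → OK-sym (OK-undirected (──-sym e) j∉Z (r lt)))

      inRight : ∀ {i} → v i ↦ v (suc i) → InRight (suc i)
      inRight e lt = (λ f → coll (ok inner lt) e f) , (λ f → outʳ (ok inner lt) (inj₁ f))

      inLeft : ∀ {i} → i < n → v (suc i) ↦ v i → InLeft i
      inLeft lt e refl = (λ f → coll (ok inner lt) f e) , (λ f → outˡ (ok inner lt) (inj₁ f))

      tail∉Zʳ : ∀ {i} → i < n → v i ⊸ v (suc i) → v i ∉ Z
      tail∉Zʳ {zero}  _  _ = v₀∉Z
      tail∉Zʳ {suc i} lt e = outʳ (ok inner lt) e

      tail∉Zˡ : ∀ {i} → i < n → v (suc i) ⊸ v i → v (suc i) ∉ Z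
      tail∉Zˡ {i} lt e with m≤n⇒m<n∨m≡n lt
      ... | inj₁ lt′  = outˡ (ok inner lt′) e
      ... | inj₂ refl = vₙ∉Z

      AncZ-extend : ∀ {a b} → Star _⟶_ a b → b ∈ AncZ → a ∈ AncZ
      AncZ-extend s (z , z∈Z , s′) = z , z∈Z , s ◅◅ s′

      -- An undirected continuation of a directed stretch is forbidden, so the stretch can only stop
      -- at a collider, which is an ancestor of `Z` by openness.
      follow : ∀ {i k} → i < k → k ≤ n → v i ⟶ v (suc i) →
               v i ∈ AncZ ⊎ Star _⟶_ (v (suc i)) (v k)
      follow {i} i<k k≤n e with go (≤⇒≤′ i<k) k≤n
        where
        go : ∀ {k} → suc i ≤′ k → k ≤ n →
             v i ∈ AncZ ⊎ (v (pred k) ⟶ v k × Star _⟶_ (v (suc i)) (v k))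
        go (≤′-reflexive refl) _ = inj₂ (e , ε)
        go {suc zero} (≤′-step (≤′-reflexive ())) _
        go {suc (suc k)} (≤′-step lt) k<n with go lt (<⇒≤ k<n)
        ... | inj₁ a = inj₁ a
        ... | inj₂ (g , s) with markAt (Adj-sym (adj inner k<n))
        ...   | inj₁ h        = inj₁ (AncZ-extend (e ◅ s) (coll (ok inner k<n) (inj₁ g) h))
        ...   | inj₂ (inj₁ h) = inj₂ (h , s ◅◅ (h ◅ ε))
        ...   | inj₂ (inj₂ h) = contradiction h (forbʳ (ok inner k<n) (inj₁ g))
      ... | inj₁ a       = inj₁ a
      ... | inj₂ (_ , s) = inj₂ s

      -- If an end of the walk is repeated, a piece can be cut off. Otherwise the edge that leads to
      -- the first occurrence also leads to the second one and serves as a shortcut.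
      distinct : ∀ {i j} → i < j → j ≤ n → v i ≢ v j
      distinct {zero} {j} 0<j j≤n eq = minimal
        (record { inner  = suffix j≤n ; start≡ = trans (sym eq) start≡
                ; end≡   = trans (cong v (m∸n+n≡m j≤n)) end≡ ; x∉Z = x∉Z ; y∉Z = y∉Z })
        (subst (λ k → weight (n ∸ j) (λ k → v (k + j)) < weight k v) (m∸n+n≡m j≤n)
               (weight-suffix< (n ∸ j) v 0<j))
      distinct {suc h} {suc j} h<j j<n eq with m≤n⇒m<n∨m≡n j<n
      ... | inj₂ refl = minimal
        (record { inner = inner-prefix (<⇒≤ h<j) inner ; start≡ = start≡
                ; end≡ = trans eq end≡ ; x∉Z = x∉Z ; y∉Z = y∉Z })
        (weight-prefix< v h<j)
      ... | inj₁ j<n′ = edge (adj inner h<n)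
        where
        h<n : suc h ≤ n
        h<n = <⇒≤ (<-≤-trans h<j j<n)
        sh<n : suc h < n
        sh<n = <-≤-trans h<j j<n
        o = ok inner sh<n
        -- v (suc h) is an ancestor of Z or begins a directed cycle through v (suc j).
        ancestor : v h ↦ v (suc h) → v (suc j) ∈ AncZ
        ancestor e with markAt (Adj-sym (adj inner sh<n))
        ... | inj₁ f        = subst (_∈ AncZ) eq (coll o e f)
        ... | inj₂ (inj₂ f) = contradiction f (forbʳ o e)
        ... | inj₂ (inj₁ f) with follow h<j j<n f
        ...   | inj₁ a = subst (_∈ AncZ) eq a
        ...   | inj₂ s = contradiction (inj₁ f)
                  (ancestralWalk (subst (Star _⊸_ _) (sym eq) (gmap id inj₁ s)))
        right : v h ↦ v (suc h) → InRight (suc j)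
        right e lt = (λ _ → ancestor e) , (λ f → outʳ (ok inner lt) (inj₁ f))
        edge : Adj (v h) (v (suc h)) → ⊥
        edge (forward e) = bridge⟶ h<j j<n (subst (v h ⟶_) eq e)
                             (tail∉Zʳ h<n (inj₁ e)) (right (inj₁ e))
        edge (bidirected e) = bridge⟷ h<j j<n (subst (v h ⟷_) eq e)
                                (inLeft h<n (inj₂ (⟷-sym e))) (right (inj₂ e))
        edge (backward e) = bridge⟵ h<j j<n (subst (_⟶ v h) eq e)
                              (subst (_∉ Z) eq (tail∉Zˡ h<n (inj₁ e))) (inLeft h<n (inj₁ e))
        -- An arrowhead at the second occurrence would make the shortcut forbidden. It passes along
        -- the undirected edge to `v h`, and so gives a shortcut from `v h` to `v (suc (suc j))`
        -- instead.
        edge (undirected e) with markAt (Adj-sym (adj inner j<n′))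
        ... | inj₁ f = case f of λ
                { (inj₁ g) → bridge⟵ (m≤n⇒m≤1+n h<j) j<n′ (⟶-── g e″) (tail∉Zˡ j<n′ (inj₁ g)) left
                ; (inj₂ g) → bridge⟷ (m≤n⇒m≤1+n h<j) j<n′ (⟷-sym (⟷-── g e″)) left
                                     (inRight (inj₂ (⟷-sym g))) }
          where
          e″ : v (suc j) ── v h
          e″ = ──-sym (subst (v h ──_) eq e)
          left : InLeft h
          left refl = (λ f → contradiction e (forbʳ (ok inner h<n) f)) ,
                      (λ f → outˡ (ok inner h<n) (inj₁ f))
        ... | inj₂ f = bridge── h<j j<n (subst (v h ──_) eq e)
                (tail∉Zʳ h<n (inj₂ e)) (subst (_∉ Z) eq (tail∉Zˡ h<n (inj₂ (──-sym e))))
                (λ { refl g → forbʳ (ok inner h<n) g e })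
                (λ _ → ⊸⇒¬↤ f)

      -- Moving left from a collider with an edge to `d`, one looks for a node where the walk can
      -- turn to `d`. A neighbour adjacent to `d` has an arrowhead at `d`. It prevents the turn only
      -- if it lies in `Z` and has the edge `⟷` on the walk but `⟶` to `d`; then it is itself a
      -- collider with an edge to `d`, and the search goes on.
      connect : ∀ k {d} → suc k < n → CollAt v (suc k) → v (suc k) ⟶ d →
                Σ[ l ∈ ℕ ] l < suc k
                  × (∀ {q} → l < q → q ≤ suc k → CollAt v q × v q ⟶ d)
                  × (¬ Adj (v l) d ⊎ v l ↦ d × LeftOK l d)
      connect k {d} lt c e = step k lt c e
        where
        only : ∀ {k q} → CollAt v (suc k) → v (suc k) ⟶ d → k < q → q ≤ suc k → CollAt v q × v q ⟶ d
        only c e p q rewrite ≤-antisym q p = c , e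
        step : ∀ k → suc k < n → CollAt v (suc k) → v (suc k) ⟶ d →
               Σ[ l ∈ ℕ ] l < suc k
                 × (∀ {q} → l < q → q ≤ suc k → CollAt v q × v q ⟶ d)
                 × (¬ Adj (v l) d ⊎ v l ↦ d × LeftOK l d)
        step k lt c e with em {P = Adj (v k) d}
        ... | no ¬a = k , ≤-refl , only c e , inj₁ ¬a
        ... | yes a with proj₁ c | ↦-⟶ (proj₁ c) e a
        ...   | inj₁ f | _ = k , ≤-refl , only c e ,
                inj₂ (inj₁ (⟶-⟶ f e a) ,
                      (λ { refl → OK-⟶ f (⟶-⟶ f e a) (ok inner (<-trans (n<1+n _) lt)) }))
        ...   | inj₂ f | inj₂ g = k , ≤-refl , only c e ,
                inj₂ (inj₂ g , (λ { refl → OK-⟷ f g (ok inner (<-trans (n<1+n _) lt)) }))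
        ...   | inj₂ f | inj₁ g = go k lt c e f g
          where
          go : ∀ k → suc k < n → CollAt v (suc k) → v (suc k) ⟶ d → v k ⟷ v (suc k) → v k ⟶ d →
               Σ[ l ∈ ℕ ] l < suc k
                 × (∀ {q} → l < q → q ≤ suc k → CollAt v q × v q ⟶ d)
                 × (¬ Adj (v l) d ⊎ v l ↦ d × LeftOK l d)
          go zero    lt c e f g = 0 , ≤-refl , only c e , inj₂ (inj₁ g , (λ ()))
          go (suc k) lt c e f g with em {P = v (suc k) ∈ Z}
          ... | no  ∉Z = suc k , ≤-refl , only c e , inj₂ (inj₁ g , (λ { refl → OK-out g ∉Z }))
          ... | yes ∈Z with markAt (adj inner (<-trans (n<1+n _) (<-trans (n<1+n _) lt)))
          ...   | inj₂ h = contradiction ∈Z (outˡ (ok inner (<-trans (n<1+n _) lt)) h)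
          ...   | inj₁ h with step k (<-trans (n<1+n _) lt) (h , inj₂ (⟷-sym f)) g
          ...     | l , l< , btw , r = l , m<n⇒m<1+n l< , btw′ , r
            where
            btw′ : ∀ {q} → l < q → q ≤ suc (suc k) → CollAt v q × v q ⟶ d
            btw′ p q with m≤n⇒m<n∨m≡n q
            ... | inj₁ (s≤s q′) = btw p q′
            ... | inj₂ refl     = c , e

      ∈Z⇒collider : ∀ {k} → suc k < n → v (suc k) ∈ Z → CollAt v (suc k)
      ∈Z⇒collider lt ∈Z with markAt (adj inner (<-trans (n<1+n _) lt)) | markAt (Adj-sym (adj inner lt))
      ... | inj₁ e | inj₁ f = e , f
      ... | inj₂ e | _      = contradiction ∈Z (outˡ (ok inner lt) e)
      ... | inj₁ _ | inj₂ f = contradiction ∈Z (outʳ (ok inner lt) f)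

      module Shielded {k} (lt : suc k < n) where
        private
          k<n : k < n
          k<n = <-trans (n<1+n k) lt

        -- Without the middle node, `v (suc (suc k))` may become a new collider. If its old edge was
        -- `⟶` towards the middle node, `into` shows that this node was a collider, hence an
        -- ancestor of `Z`, and so is `v (suc (suc k))`.
        inRight⁺ : (v (suc (suc k)) ⟶ v (suc k) → v k ↦ v (suc k)) → InRight (suc (suc k))
        inRight⁺ into lt′ = ancestor , (λ f → outʳ (ok inner lt′) (inj₁ f))
          where
          ancestor : v (suc (suc (suc k))) ↦ v (suc (suc k)) → v (suc (suc k)) ∈ AncZ
          ancestor f with markAt (adj inner lt)
          ... | inj₁ g        = coll (ok inner lt′) g f
          ... | inj₂ (inj₁ g) = AncZ-extend (g ◅ ε) (coll (ok inner lt) (into g) (inj₁ g))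
          ... | inj₂ (inj₂ g) = contradiction g (forbˡ (ok inner lt′) f)

        inLeft⁺ : (v k ⟶ v (suc k) → v (suc (suc k)) ↦ v (suc k)) → InLeft k
        inLeft⁺ into {h} refl = ancestor , (λ f → outˡ (ok inner k<n) (inj₁ f))
          where
          ancestor : v h ↦ v k → v k ∈ AncZ
          ancestor f with markAt (Adj-sym (adj inner k<n))
          ... | inj₁ g        = coll (ok inner k<n) f g
          ... | inj₂ (inj₁ g) = AncZ-extend (g ◅ ε) (coll (ok inner lt) (inj₁ g) (into g))
          ... | inj₂ (inj₂ g) = contradiction g (forbʳ (ok inner k<n) f)

        inRight-shield : v k ↦ v (suc (suc k)) → InRight (suc (suc k))
        inRight-shield e = inRight⁺ (λ g → ↦-⟶ e g (adj inner k<n))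

        shielded⟷ : ¬ v k ⟷ v (suc (suc k))
        shielded⟷ e = bridge⟷ ≤-refl lt e
          (inLeft⁺ (λ g → ↦-⟶ (inj₂ (⟷-sym e)) g (Adj-sym (adj inner lt))))
          (inRight-shield (inj₂ e))

        -- If no arrowhead meets the undirected shortcut, its ends avoid `Z` and it is open. An
        -- arrowhead at one end passes to the other end, which yields a directed or bidirected
        -- shortcut that skips one more node.
        shielded── : ¬ v k ── v (suc (suc k))
        shielded── e = left k refl
          where
          r : InRight (suc (suc k))
          r = inRight⁺ (λ g → inj₁ (──-⟶ e g (adj inner k<n)))
          l : InLeft k
          l = inLeft⁺ (λ g → inj₁ (──-⟶ (──-sym e) g (Adj-sym (adj inner lt))))
          right : v k ∉ Z → (∀ {h} → k ≡ suc h → ¬ v h ↦ v k) → ⊥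
          right k∉Z p with m≤n⇒m<n∨m≡n lt
          ... | inj₂ refl = bridge── ≤-refl lt e k∉Z vₙ∉Z p (λ lt → contradiction lt (<-irrefl refl))
          ... | inj₁ lt′ with markAt (Adj-sym (adj inner lt′))
          ...   | inj₁ (inj₁ f) = bridge⟵ (m<n⇒m<1+n ≤-refl) lt′ (⟶-── f (──-sym e))
                                    (tail∉Zˡ lt′ (inj₁ f)) l
          ...   | inj₁ (inj₂ f) = bridge⟷ (m<n⇒m<1+n ≤-refl) lt′ (⟷-sym (⟷-── f (──-sym e))) l
                                    (inRight (inj₂ (⟷-sym f)))
          ...   | inj₂ f = bridge── ≤-refl lt e k∉Z (outʳ (ok inner lt′) f) p (λ _ → ⊸⇒¬↤ f)
          left : ∀ h → h ≡ k → ⊥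
          left zero    refl = right v₀∉Z (λ ())
          left (suc h) refl with markAt (adj inner (<-trans (n<1+n h) k<n))
          ... | inj₁ (inj₁ f) = bridge⟶ (m<n⇒m<1+n ≤-refl) lt (⟶-── f e)
                                  (tail∉Zʳ (<-trans (n<1+n h) k<n) (inj₁ f)) r
          ... | inj₁ (inj₂ f) = bridge⟷ (m<n⇒m<1+n ≤-refl) lt (⟷-── f e)
                                  (inLeft (<-trans (n<1+n h) k<n) (inj₂ (⟷-sym f))) r
          ... | inj₂ f = right (outˡ (ok inner k<n) f) (λ { refl → ⊸⇒¬↤ f })

        -- This shortcut can fail only if `v k` lies in `Z`. Then `v k` is a collider and `connect`
        -- applies with `d` equal to `v (suc (suc k))`; a turn to `d` would be a longer shortcut, so
        -- the search ends with a discriminating segment.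
        shielded⟶ : v k ⟶ v (suc (suc k)) → Σ[ l ∈ ℕ ] Discriminates v (suc k) l
        shielded⟶ e with em {P = v k ∈ Z}
        ... | no  ∉Z = contradiction (inRight-shield (inj₁ e)) (bridge⟶ ≤-refl lt e ∉Z)
        ... | yes ∈Z = go k refl
          where
          left∉Z : ∀ {l} → v l ⟶ v (suc (suc k)) → LeftOK l (v (suc (suc k))) → v l ∉ Z
          left∉Z {zero}  _ _ = v₀∉Z
          left∉Z {suc l} f o = outʳ (o refl) (inj₁ f)
          go : ∀ h → h ≡ k → Σ[ l ∈ ℕ ] Discriminates v (suc k) l
          go zero    refl = contradiction ∈Z v₀∉Z
          go (suc h) refl with connect h k<n (∈Z⇒collider k<n ∈Z) e
          ... | l , l<k , btw , inj₁ ¬adj = l , record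
            { l<p = m<n⇒m<1+n l<k ; nonadj = ¬adj ; between = λ { p (s≤s q) → btw p q } }
          ... | l , l<k , btw , inj₂ (inj₁ f , o) =
            contradiction (inRight-shield (inj₁ e)) (bridge⟶ (s≤s (m<n⇒m<1+n l<k)) lt f (left∉Z f o))
          ... | l , l<k , btw , inj₂ (inj₂ f , o) =
            contradiction (inRight-shield (inj₁ e))
              (bridge⟷ (s≤s (m<n⇒m<1+n l<k)) lt f
                 (λ { refl → (λ g → coll (o refl) g (inj₂ (⟷-sym f))) ,
                             (λ g → outˡ (o refl) (inj₁ g)) }))

        dichotomy : (Σ[ l ∈ ℕ ] Discriminates v (suc k) l) ⊎ v (suc (suc k)) ⟶ v k
        dichotomy with em {P = Adj (v k) (v (suc (suc k)))}
        ... | no ¬a = inj₁ (k , record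
          { l<p = ≤-refl ; nonadj = ¬a
          ; between = λ { p (s≤s q) → contradiction (<-≤-trans p q) (<-irrefl refl) } })
        ... | yes (forward e)    = inj₁ (shielded⟶ e)
        ... | yes (backward e)   = inj₂ e
        ... | yes (bidirected e) = contradiction e shielded⟷
        ... | yes (undirected e) = contradiction e shielded──

-- Reversal, and discrimination from either side

suc[n∸1+m]≡n∸m : ∀ {m n} → m < n → suc (n ∸ suc m) ≡ n ∸ m
suc[n∸1+m]≡n∸m m<n = sym (+-∸-assoc 1 m<n)

module MinimalWalks (em : ExcludedMiddle ℓ) {V : Set ℓ} (H : MixedGraph V) (mag : IsσMAG H)
                    (Z : Pred V ℓ) (f : V → ℕ) where
  open Sequences em H mag Z public
  open Minimality f public

  private
    variable
      x y : V
      n : ℕ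
      v : ℕ → V

  rev-∸ : ∀ {j} → j ≤ n → rev n v (n ∸ j) ≡ v j
  rev-∸ {v = v} le = cong v (m∸[m∸n]≡n le)

  rev-pred : ∀ {k} → suc k < n → rev n v (pred (n ∸ suc k)) ≡ v (suc (suc k))
  rev-pred {n = n} {v} {k} lt =
    trans (cong (rev n v) (pred[m∸n]≡m∸[1+n] n (suc k))) (rev-∸ {v = v} lt)

  rev-suc : ∀ {k} → k < n → rev n v (suc (n ∸ suc k)) ≡ v k
  rev-suc {n = n} {v} lt = trans (cong (rev n v) (suc[n∸1+m]≡n∸m lt)) (rev-∸ {v = v} (<⇒≤ lt))

  triple-rev : (C : V → V → V → Set ℓ) → ∀ {k} → suc k < n →
    C (rev n v (pred (n ∸ suc k))) (rev n v (n ∸ suc k)) (rev n v (suc (n ∸ suc k)))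
    ≡ C (v (suc (suc k))) (v (suc k)) (v k)
  triple-rev {n = n} {v} C {k} lt =
    trans (cong₂ (λ a b → C a b (rev n v (suc (n ∸ suc k)))) (rev-pred {v = v} lt) (rev-∸ {v = v} (<⇒≤ lt)))
          (cong (C (v (suc (suc k))) (v (suc k))) (rev-suc {v = v} (<-trans (n<1+n k) lt)))

  rev-nonadj : ∀ {q l} → suc q < n → Discriminates (rev n v) (n ∸ suc q) l → ¬ Adj (rev n v l) (v q)
  rev-nonadj {v = v} {q} {l} lt D =
    subst (λ a → ¬ Adj (rev _ v l) a) (rev-suc {v = v} (<-trans (n<1+n q) lt)) (Discriminates.nonadj D)

  rev-between : ∀ {q l p} → suc q < n → Discriminates (rev n v) (n ∸ suc q) l →
                suc q < p → p < n → l < n ∸ p → CollAt v p × v p ⟶ v q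
  rev-between {n = n} {v} {q} {l} {suc p} q<n D q<p p<n l<
    with Discriminates.between D l< (∸-monoʳ-< q<p (<⇒≤ p<n))
  ... | c , e with subst (λ P → P) (triple-rev {v = v} Coll p<n) c
  ...   | c₁ , c₂ =
    (c₂ , c₁) , subst₂ _⟶_ (rev-∸ {v = v} (<⇒≤ p<n)) (rev-suc {v = v} (<-trans (n<1+n q) q<n)) e

  classify : Minimal x y n v → ∀ {k} → suc k < n →
             (Σ[ l ∈ ℕ ] Discriminates v (suc k) l)
             ⊎ (Σ[ l ∈ ℕ ] Discriminates (rev n v) (n ∸ suc k) l)
  classify {n = n} {v} M {k} lt with Shortcuts.Shielded.dichotomy M lt
  ... | inj₁ D = inj₁ D
  ... | inj₂ e = inj₂ (subst (λ p → Σ[ l ∈ ℕ ] Discriminates (rev n v) p l) eq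
      (Shortcuts.Shielded.shielded⟶ (minimal-rev M) (subst (_< n) (sym eq) (∸-monoʳ-< z<s (<⇒≤ lt)))
        (subst₂ _⟶_ (sym (rev-∸ {v = v} lt))
                    (trans (sym (rev-suc {v = v} k<n)) (cong (rev n v ∘ suc) (sym eq))) e)))
    where
    k<n = <-trans (n<1+n k) lt
    eq : suc (n ∸ suc (suc k)) ≡ n ∸ suc k
    eq = suc[n∸1+m]≡n∸m lt

  -- Otherwise v p ⟶ v (pred q).  This contradicts v (pred q) ⟶ v (suc p), or, if
  -- pred q = l, makes v l , … , v (suc p) an inducing path.
  discriminates-nested : Minimal x y n v → ∀ {p q l m} → p < n → Discriminates v p l → l < q → q < p →
                         Discriminates (rev n v) (n ∸ q) m → n ∸ p ≤ m
  discriminates-nested {n = n} {v} M {p} {suc q} {l} {m} p<n D l<q q<p E with n ∸ p ≤? m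
  ... | yes le = le
  ... | no ¬le with m≤n⇒m<n∨m≡n l<q
  ...   | inj₁ (s≤s l<q′) = ⊥-elim (go (m≤n⇒m<n∨m≡n m≤))
    where
    open Discriminates D
    q<n = <-trans q<p p<n
    e : v q ⟶ v (suc p)
    e = proj₂ (between l<q′ (<-trans (n<1+n q) q<p))
    m≤ : m ≤ n ∸ suc p
    m≤ = s≤s⁻¹ (subst (m <_) (sym (suc[n∸1+m]≡n∸m p<n)) (≰⇒> ¬le))
    -- The segment from the right starts at `v (suc p)`, which is adjacent to `v q`, or further
    -- right, and then `v (suc p) ⟶ v q` closes a cycle.
    go : m < n ∸ suc p ⊎ m ≡ n ∸ suc p → ⊥
    go (inj₂ refl) = rev-nonadj {v = v} q<n E
                       (subst (λ a → Adj a (v q)) (sym (rev-∸ {v = v} p<n)) (backward e))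
    go (inj₁ m<)   = ⟶⇒¬↤ e (inj₁ (proj₂ (rev-between {v = v} q<n E (m<n⇒m<1+n q<p) (≰⇒> λ n≤ →
                       contradiction (subst (m <_) (m≤n⇒m∸n≡0 n≤) m<) λ ()) m<)))
  ...   | inj₂ refl = ⊥-elim (go (p ∸ q) (m∸n+n≡m (<⇒≤ (<-trans (n<1+n q) q<p))))
    where
    open Discriminates D
    open Shortcuts M using (inner; distinct)
    q<n = <-trans q<p p<n
    last : CollAt v p × v p ⟶ v q
    last = rev-between {v = v} q<n E q<p p<n (≰⇒> ¬le)
    go : ∀ d → d + q ≡ p → ⊥
    go d refl = no-inducing (suc d) {λ k → v (k + q)}
      (λ k lt → adj inner (<-≤-trans (+-monoˡ-< q lt) p<n))
      (λ lt le → distinct (+-monoˡ-< q lt) (≤-trans (+-monoˡ-≤ q le) p<n)) z<s nonadj colliders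
      where
      colliders : ∀ {k} → suc k < suc d →
                  CollAt v (suc k + q) × v (suc k + q) ∈ AncSet H (｛ v q ｝ ∪ ｛ v (suc d + q) ｝)
      colliders {k} (s≤s lt) with m≤n⇒m<n∨m≡n lt
      ... | inj₂ refl = proj₁ last , _ , inj₁ refl , proj₂ last ◅ ε
      ... | inj₁ lt′  with between (s≤s (m≤n+m q k)) (+-monoˡ-< q lt′)
      ...   | c , e = c , _ , inj₂ refl , e ◅ ε

-- Transfer along discriminating paths

applyUpTo-snoc₂ : {A : Set ℓ} (f : ℕ → A) (n : ℕ) →
                  applyUpTo f (suc (suc n)) ≡ applyUpTo f n ++ f n ∷ f (suc n) ∷ []
applyUpTo-snoc₂ f zero    = refl
applyUpTo-snoc₂ f (suc n) = cong (f 0 ∷_) (applyUpTo-snoc₂ (f ∘ suc) n)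

join-mid : {V : Set ℓ} (l : ℕ) {v w : ℕ → V} → join l v w (suc l) ≡ w 0
join-mid l = join-right l 0

module Transfer (em : ExcludedMiddle ℓ) {V : Set ℓ} (H₁ H₂ : MixedGraph V)
                (mag₁ : IsσMAG H₁) (mag₂ : IsσMAG H₂)
                (sameAdj : SameAdjacencies H₁ H₂)
                (sameUnshielded : SameUnshieldedColliders H₁ H₂)
                (sameDiscriminated : SameDiscriminatedColliders H₁ H₂) where
  module G₁ = Graph em H₁ mag₁
  module G₂ = Graph em H₂ mag₂
  open Equivalence

  adj₁₂ : ∀ {a b} → G₁.Adj a b → G₂.Adj a b
  adj₁₂ = to (sameAdj _ _)

  adj₂₁ : ∀ {a b} → G₂.Adj a b → G₁.Adj a b
  adj₂₁ = from (sameAdj _ _)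

  SameCollAt : (ℕ → V) → ℕ → Set ℓ
  SameCollAt v p = G₁.CollAt v p ⇔ G₂.CollAt v p

  -- A discriminating path for `v m` that ends in `c`, or an unshielded triple if `m = 1`, before it
  -- is known to discriminate in `H₂`: the edges to `c` are given in `H₁` only. The edge between
  -- `v m` and `c` is left to the lemmas that use it.
  record DiscriminatedFrom (v : ℕ → V) (m : ℕ) (c : V) : Set ℓ where
    field
      adj      : ∀ {k} → k < m → G₁.Adj (v k) (v (suc k))
      distinct : ∀ {j k} → j < k → k ≤ m → v j ≢ v k
      avoids   : ∀ {k} → k ≤ m → v k ≢ c
      nonadj   : ¬ G₁.Adj (v 0) c
      coll₁    : ∀ {j} → 0 < j → j < m → G₁.CollAt v j
      coll₂    : ∀ {j} → 0 < j → j < m → G₂.CollAt v j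
      into₁    : ∀ {j} → 0 < j → j < m → v j G₁.⟶ c

  private
    variable
      v : ℕ → V
      m : ℕ
      c : V

    sameCollOnPath : ∀ N (v : ℕ → V) → (∀ k → k < N → G₁.Adj (v k) (v (suc k))) →
                     (∀ {j k} → j < k → k ≤ N → v j ≢ v k) → ¬ G₁.Adj (v 0) (v N) →
                     ∀ m {x xs} → suc m < N →
                     applyUpTo v (suc N) ≡ v 0 ∷ (x ∷ xs) ++ v (suc m) ∷ v N ∷ [] →
                     (∀ {u} → u ∈ₗ x ∷ xs → Σ[ i ∈ ℕ ] suc i < N × u ≡ v (suc i)
                                              × (G₁.CollAt v (suc i) × u G₁.⟶ v N)
                                              × (G₂.CollAt v (suc i) × u G₂.⟶ v N)) →
                     SameCollAt v (suc m)
    sameCollOnPath N v adj distinct ¬adj m {x} {xs} m<N shape between = mk⇔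
      (λ p → G₂.ColliderOn⇒CollAt N distinct m<N (to same (G₁.CollAt⇒ColliderOn N m<N p)))
      (λ p → G₁.ColliderOn⇒CollAt N distinct m<N (from same (G₂.CollAt⇒ColliderOn N m<N p)))
      where
      π₁ : Walk H₁ (v 0) (v N)
      π₁ = walkAlong N v adj
      π₂ : Walk H₂ (v 0) (v N)
      π₂ = walkAlong N v (λ k lt → adj₁₂ (adj k lt))
      between₁ : ∀ {u} → u ∈ₗ x ∷ xs → ColliderOn H₁ π₁ u × u G₁.⟶ v N
      between₁ u∈ with between u∈
      ... | i , lt , refl , (p , e) , _ = G₁.CollAt⇒ColliderOn N lt p , e
      between₂ : ∀ {u} → u ∈ₗ x ∷ xs → ColliderOn H₂ π₂ u × u G₂.⟶ v N
      between₂ u∈ with between u∈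
      ... | i , lt , refl , _ , (p , e) = G₂.CollAt⇒ColliderOn N lt p , e
      same : ColliderOn H₁ π₁ (v (suc m)) ⇔ ColliderOn H₂ π₂ (v (suc m))
      same = sameDiscriminated π₁ π₂
        (trans (nodes-walkAlong N) (sym (nodes-walkAlong N))) (v (suc m))
        (walkAlong-path N distinct , ¬adj , _ , _ , trans (nodes-walkAlong N) shape , between₁)
        (walkAlong-path N distinct , ¬adj ∘ adj₂₁ , _ , _ , trans (nodes-walkAlong N) shape , between₂)

    -- The case `m = 1` is the unshielded triple, which `Discriminating` does not cover because it
    -- asks for a node `v₀`.
    sameColl′ : ∀ m (v : ℕ → V) → (∀ k → k < suc m → G₁.Adj (v k) (v (suc k))) →
                (∀ {j k} → j < k → k ≤ suc m → v j ≢ v k) → ¬ G₁.Adj (v 0) (v (suc m)) →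
                (∀ {j} → 0 < j → j < m → (G₁.CollAt v j × v j G₁.⟶ v (suc m))
                                       × (G₂.CollAt v j × v j G₂.⟶ v (suc m))) →
                0 < m → SameCollAt v m
    sameColl′ (suc zero) v adj distinct ¬adj _ _ = mk⇔
      (λ p → proj₂ (to (sameUnshielded _ _ _) ((dist , G₁.Adj-sym (adj 0 z<s) , adj 1 ≤-refl , ¬adj) , p)))
      (λ p → proj₂ (from (sameUnshielded _ _ _) ((dist , G₂.Adj-sym (adj₁₂ (adj 0 z<s)) ,
                                                 adj₁₂ (adj 1 ≤-refl) , ¬adj ∘ adj₂₁) , p)))
      where
      dist = distinct z<s (s≤s z≤n) , distinct ≤-refl ≤-refl , distinct z<s ≤-refl
    sameColl′ (suc (suc m)) v adj distinct ¬adj between _ =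
      sameCollOnPath (suc (suc (suc m))) v adj distinct ¬adj (suc m) ≤-refl
        (cong (v 0 ∷_) (applyUpTo-snoc₂ (v ∘ suc) (suc m))) between′
      where
      between′ : ∀ {u} → u ∈ₗ applyUpTo (v ∘ suc) (suc m) → _
      between′ u∈ with ∈-applyUpTo⁻ (v ∘ suc) u∈
      ... | i , lt , refl = i , m<n⇒m<1+n (s≤s lt) , refl , between z<s (s≤s lt)

    module _ (D : DiscriminatedFrom v m c) where
      open DiscriminatedFrom D

      sameColl : (∀ {j} → 0 < j → j < m → v j G₂.⟶ c) → 0 < m → G₁.Adj (v m) c →
                 G₁.Coll (v (pred m)) (v m) c ⇔ G₂.Coll (v (pred m)) (v m) c
      sameColl into₂ 0<m e =
        subst₂ (λ P Q → P ⇔ Q) (coll≡ G₁.Coll) (coll≡ G₂.Coll)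
          (sameColl′ m t adjₜ distinctₜ (λ a → nonadj (subst (G₁.Adj (v 0)) tEnd a)) betweenₜ 0<m)
        where
        t = join m v (λ _ → c)
        tEnd : t (suc m) ≡ c
        tEnd = join-mid m
        t≡ : ∀ {k} → k ≤ m → t k ≡ v k
        t≡ = join-left m
        coll≡ : (C : V → V → V → Set ℓ) → C (t (pred m)) (t m) (t (suc m)) ≡ C (v (pred m)) (v m) c
        coll≡ C = trans (cong₂ (λ a b → C a b (t (suc m))) (t≡ pred[n]≤n) (t≡ ≤-refl)) (cong (C _ _) tEnd)
        adjₜ : ∀ k → k < suc m → G₁.Adj (t k) (t (suc k))
        adjₜ k (s≤s k≤m) with m≤n⇒m<n∨m≡n k≤m
        ... | inj₁ lt   = subst₂ G₁.Adj (sym (t≡ k≤m)) (sym (t≡ lt)) (adj lt)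
        ... | inj₂ refl = subst₂ G₁.Adj (sym (t≡ k≤m)) (sym tEnd) e
        distinctₜ : ∀ {j k} → j < k → k ≤ suc m → t j ≢ t k
        distinctₜ {j} {k} lt le eq with m≤n⇒m<n∨m≡n le
        ... | inj₁ (s≤s k≤m) = distinct lt k≤m
                (trans (sym (t≡ (<⇒≤ (<-≤-trans lt k≤m)))) (trans eq (t≡ k≤m)))
        ... | inj₂ refl = avoids (s≤s⁻¹ lt) (trans (sym (t≡ (s≤s⁻¹ lt))) (trans eq tEnd))
        betweenₜ : ∀ {j} → 0 < j → j < m → (G₁.CollAt t j × t j G₁.⟶ t (suc m))
                                         × (G₂.CollAt t j × t j G₂.⟶ t (suc m))
        betweenₜ {j} p q = (back G₁.Coll (coll₁ p q) ,
                            subst₂ G₁._⟶_ (sym (t≡ (<⇒≤ q))) (sym tEnd) (into₁ p q)) ,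
                           (back G₂.Coll (coll₂ p q) ,
                            subst₂ G₂._⟶_ (sym (t≡ (<⇒≤ q))) (sym tEnd) (into₂ p q))
          where
          back : (C : V → V → V → Set ℓ) → C (v (pred j)) (v j) (v (suc j)) →
                 C (t (pred j)) (t j) (t (suc j))
          back C = subst (λ P → P) (sym (trans
            (cong₂ (λ a b → C a b (t (suc j))) (t≡ (≤-trans pred[n]≤n (<⇒≤ q))) (t≡ (<⇒≤ q)))
            (cong (C _ _) (t≡ q))))

      -- An arrowhead at `v m` in `H₂` would make `v m` a collider there, hence in `H₁`, against
      -- `v m ⟶ c`. An undirected edge makes `v 0` adjacent to `c` if `m = 1`; otherwise it turns
      -- `v (pred m) ⟶ c` into `v (pred m) ⟶ v m`, although `v (pred m)` is a collider.
      into-step : (∀ {j} → 0 < j → j < m → v j G₂.⟶ c) → 0 < m →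
                  v m G₁.⟶ c → v (pred m) G₂.↦ v m → v m G₂.⟶ c
      into-step into₂ 0<m e g with G₂.markAt (G₂.Adj-sym (adj₁₂ (forward e)))
      ... | inj₁ h = contradiction (proj₂ (from (sameColl into₂ 0<m (forward e)) (g , h))) (G₁.⟶⇒¬↤ e)
      ... | inj₂ (inj₁ h) = h
      ... | inj₂ (inj₂ h) = ⊥-elim (undirected-case m refl)
        where
        undirected-case : ∀ k → k ≡ m → ⊥
        undirected-case zero          refl = contradiction 0<m λ ()
        undirected-case (suc zero)    refl = nonadj (adj₂₁ (G₂.↦⇒Adj (G₂.↦-── g h)))
        undirected-case (suc (suc k)) refl =
          G₂.⟶⇒¬↤ (G₂.⟶-── (into₂ z<s ≤-refl) (G₂.──-sym h)) (proj₂ (coll₂ z<s ≤-refl))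

  restrict : ∀ {k} → k ≤ m → DiscriminatedFrom v m c → DiscriminatedFrom v k c
  restrict k≤m D = record
    { adj = λ lt → adj (<-≤-trans lt k≤m) ; distinct = λ lt le → distinct lt (≤-trans le k≤m)
    ; avoids = λ le → avoids (≤-trans le k≤m) ; nonadj = nonadj
    ; coll₁ = λ p q → coll₁ p (<-≤-trans q k≤m) ; coll₂ = λ p q → coll₂ p (<-≤-trans q k≤m)
    ; into₁ = λ p q → into₁ p (<-≤-trans q k≤m) }
    where open DiscriminatedFrom D

  -- Each initial part of the segment discriminates its own last node with the same `c`, so the
  -- edges to `c` transfer one by one from the left.
  into-transfer : DiscriminatedFrom v m c → ∀ {j} → 0 < j → j < m → v j G₂.⟶ c
  into-transfer {v} {m} {c} D {j} = <-rec (λ j → 0 < j → j < m → v j G₂.⟶ c) step j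
    where
    open DiscriminatedFrom D
    step : ∀ j → (∀ {i} → i < j → 0 < i → i < m → v i G₂.⟶ c) → 0 < j → j < m → v j G₂.⟶ c
    step j rec 0<j j<m = into-step (restrict (<⇒≤ j<m) D)
      (λ 0<i i<j → rec i<j 0<i (<-trans i<j j<m)) 0<j (into₁ 0<j j<m) (proj₁ (coll₂ 0<j j<m))

  into-end : DiscriminatedFrom v m c → 0 < m → v m G₁.⟶ c → v (pred m) G₂.↦ v m → v m G₂.⟶ c
  into-end D = into-step D (into-transfer D)

  sameColl-end : DiscriminatedFrom v m c → 0 < m → G₁.Adj (v m) c →
                 G₁.Coll (v (pred m)) (v m) c ⇔ G₂.Coll (v (pred m)) (v m) c
  sameColl-end D = sameColl D (into-transfer D)

-- Directed distance to the conditioning set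

module Distance (em : ExcludedMiddle ℓ) {V : Set ℓ} (H : MixedGraph V) (Z : Pred V ℓ) where
  open MixedGraph H

  private
    variable
      u d : V

  Reaches : ℕ → V → Set ℓ
  Reaches zero    u = u ∈ Z
  Reaches (suc k) u = Σ[ d ∈ V ] u ⟶ d × Reaches k d

  Shortest : V → Set ℓ
  Shortest u = Σ[ k ∈ ℕ ] Reaches k u × (∀ {j} → j < k → ¬ Reaches j u)

  -- Zero if u is not an ancestor of Z.
  dist : V → ℕ
  dist u with em {P = Shortest u}
  ... | yes (k , _) = k
  ... | no  _       = 0

  shortest : ∀ k → Reaches k u → Shortest u
  shortest {u} = <-rec (λ k → Reaches k u → Shortest u) step
    where
    step : ∀ k → (∀ {j} → j < k → Reaches j u → Shortest u) → Reaches k u → Shortest u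
    step k rec r with em {P = Σ[ j ∈ ℕ ] j < k × Reaches j u}
    ... | yes (j , lt , r′) = rec lt r′
    ... | no  none          = k , r , λ lt r′ → none (_ , lt , r′)

  dist-reaches : ∀ k → Reaches k u → Reaches (dist u) u × dist u ≤ k
  dist-reaches {u} k r with em {P = Shortest u}
  ... | yes (j , r′ , min) = r′ , ≮⇒≥ (λ lt → min lt r)
  ... | no  none           = contradiction (shortest k r) none

  anc⇒reaches : u ∈ AncSet H Z → Σ[ k ∈ ℕ ] Reaches k u
  anc⇒reaches (z , z∈Z , ε)     = 0 , z∈Z
  anc⇒reaches (z , z∈Z , e ◅ s) with anc⇒reaches (z , z∈Z , s)
  ... | k , r = suc k , _ , e , r

  reaches⇒anc : ∀ k → Reaches k u → u ∈ AncSet H Z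
  reaches⇒anc zero    u∈Z         = _ , u∈Z , ε
  reaches⇒anc (suc k) (d , e , r) with reaches⇒anc k r
  ... | z , z∈Z , s = z , z∈Z , e ◅ s

  dist-step : u ⟶ d → d ∈ AncSet H Z → dist u ≤ suc (dist d)
  dist-step e a = proj₂ (dist-reaches (suc _) (_ , e ,
    proj₁ (dist-reaches (proj₁ (anc⇒reaches a)) (proj₂ (anc⇒reaches a)))))

  child : u ∈ AncSet H Z → u ∈ Z ⊎ Σ[ d ∈ V ] u ⟶ d × d ∈ AncSet H Z × dist u ≡ suc (dist d)
  child {u} a = go (dist u) refl (proj₁ (dist-reaches (proj₁ (anc⇒reaches a)) (proj₂ (anc⇒reaches a))))
    where
    go : ∀ k → dist u ≡ k → Reaches k u →
         u ∈ Z ⊎ Σ[ d ∈ V ] u ⟶ d × d ∈ AncSet H Z × dist u ≡ suc (dist d)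
    go zero    _  r           = inj₁ r
    go (suc k) eq (d , e , r) = inj₂ (d , e , reaches⇒anc k r ,
      ≤-antisym (dist-step e (reaches⇒anc k r))
                (subst (suc (dist d) ≤_) (sym eq) (s≤s (proj₂ (dist-reaches k r)))))

-- From the three conditions to open walks in the other graph

module Backward (em : ExcludedMiddle ℓ) {V : Set ℓ} (H₁ H₂ : MixedGraph V)
                (mag₁ : IsσMAG H₁) (mag₂ : IsσMAG H₂)
                (sameAdj : SameAdjacencies H₁ H₂)
                (sameUnshielded : SameUnshieldedColliders H₁ H₂)
                (sameDiscriminated : SameDiscriminatedColliders H₁ H₂)
                (Z : Pred V ℓ) where
  open Transfer em H₁ H₂ mag₁ mag₂ sameAdj sameUnshielded sameDiscriminated
  open Distance em H₁ Z
  module M₁ = MinimalWalks em H₁ mag₁ Z dist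
  module M₂ = MinimalWalks em H₂ mag₂ Z dist
  open Equivalence

  private
    variable
      x y d : V
      n : ℕ
      v : ℕ → V

  AllSame : ℕ → (ℕ → V) → Set ℓ
  AllSame n v = ∀ {k} → suc k < n → SameCollAt v (suc k)

  discriminatedFrom : M₁.Minimal x y n v → ∀ m {l c} → m + l < n →
    (∀ {q} → l < q → q < m + l → G₂.CollAt v q) → ¬ G₁.Adj (v l) c →
    (∀ {q} → l < q → q < m + l → G₁.CollAt v q × v q G₁.⟶ c) →
    (∀ {k} → k ≤ m → v (k + l) ≢ c) →
    DiscriminatedFrom (λ k → v (k + l)) m c
  discriminatedFrom M m {l} lt coll₂ ¬adj between avoids = record
    { adj      = λ k<m → adj inner (<-trans (+-monoˡ-< l k<m) lt)
    ; distinct = λ j<k k≤m → distinct (+-monoˡ-< l j<k) (≤-trans (+-monoˡ-≤ l k≤m) (<⇒≤ lt))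
    ; avoids   = avoids
    ; nonadj   = ¬adj
    ; coll₁    = λ { {suc j} _ q → proj₁ (between (s≤s (m≤n+m l j)) (+-monoˡ-< l q)) }
    ; coll₂    = λ { {suc j} _ q → coll₂ (s≤s (m≤n+m l j)) (+-monoˡ-< l q) }
    ; into₁    = λ { {suc j} _ q → proj₂ (between (s≤s (m≤n+m l j)) (+-monoˡ-< l q)) } }
    where
    open M₁.Shortcuts M using (inner; distinct)
    open M₁ using (adj)

  discriminated : M₁.Minimal x y n v → ∀ m {l} → m + l < n → G₁.Discriminates v (m + l) l →
    (∀ {q} → l < q → q < m + l → G₂.CollAt v q) →
    DiscriminatedFrom (λ k → v (k + l)) m (v (suc (m + l)))
  discriminated M m {l} lt D coll₂ = discriminatedFrom M m lt coll₂ nonadj between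
    (λ k≤m → M₁.Shortcuts.distinct M (s≤s (+-monoˡ-≤ l k≤m)) lt)
    where open G₁.Discriminates D

  sameColl-discriminated : M₁.Minimal x y n v → ∀ {p l} → p < n → G₁.Discriminates v p l →
    (∀ {q} → l < q → q < p → G₂.CollAt v q) → SameCollAt v p
  sameColl-discriminated {v = v} M {p} {l} p<n D coll₂ = go (p ∸ l) (m∸n+n≡m (<⇒≤ l<p))
    where
    open G₁.Discriminates D
    go : ∀ m → m + l ≡ p → SameCollAt v p
    go zero    refl = contradiction l<p (<-irrefl refl)
    go (suc m) refl = sameColl-end (discriminated M (suc m) p<n D coll₂) z<s
                        (M₁.adj (M₁.Minimal.inner M) p<n)

  swap⇔ : ∀ {a b c} → G₁.Coll a b c ⇔ G₂.Coll a b c → G₁.Coll c b a ⇔ G₂.Coll c b a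
  swap⇔ e = mk⇔ (λ (p , q) → case to e (q , p) of λ (r , s) → s , r)
                (λ (p , q) → case from e (q , p) of λ (r , s) → s , r)

  rev-same : ∀ v {k} → suc k < n → SameCollAt (rev n v) (n ∸ suc k) → SameCollAt v (suc k)
  rev-same v lt e = swap⇔ (subst₂ (λ P Q → P ⇔ Q) (M₁.triple-rev {v = v} G₁.Coll lt)
                                                         (M₂.triple-rev {v = v} G₂.Coll lt) e)

  -- A segment discriminating v p from the left refers to colliders v q with q < p.  Those
  -- discriminated from the right refer in turn only to positions between q and p.
  sameCollˡ : M₁.Minimal x y n v → ∀ p {l} → p < n → G₁.Discriminates v p l → SameCollAt v p
  sameCollˡ {n = n} {v} M p = <-rec P step p
    where
    P : ℕ → Set ℓ
    P p = ∀ {l} → p < n → G₁.Discriminates v p l → SameCollAt v p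
    step : ∀ p → (∀ {q} → q < p → P q) → P p
    step p rec {l} p<n D = sameColl-discriminated M p<n D
      (λ {q} l<q q<p → to (inside (p ∸ q) refl l<q q<p) (proj₁ (between l<q q<p)))
      where
      open G₁.Discriminates D
      Q : ℕ → Set ℓ
      Q i = ∀ {q} → p ∸ q ≡ i → l < q → q < p → SameCollAt v q
      inside-step : ∀ i → (∀ {j} → j < i → Q j) → Q i
      inside-step _ rec′ {suc q} refl l<q q<p with M₁.classify M (<-trans q<p p<n)
      ... | inj₁ (_ , D′) = rec q<p (<-trans q<p p<n) D′
      ... | inj₂ (m , E)  = rev-same v q<n
        (sameColl-discriminated (M₁.minimal-rev M) (∸-monoʳ-< z<s (<⇒≤ q<n)) E coll₂)
        where
        q<n = <-trans q<p p<n
        coll₂ : ∀ {r} → m < r → r < n ∸ suc q → G₂.CollAt (rev n v) r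
        coll₂ {r} m<r r< = go (n ∸ r) refl
          where
          r≤n : r ≤ n
          r≤n = ≤-trans (<⇒≤ r<) (m∸n≤m n (suc q))
          q<n∸r : suc q < n ∸ r
          q<n∸r = subst (_< n ∸ r) (m∸[m∸n]≡n (<⇒≤ q<n)) (∸-monoʳ-< r< (m∸n≤m n (suc q)))
          -- Nesting keeps the colliders of the right-hand segment to the left of `p`, within reach
          -- of the inner induction.
          n∸r<p : n ∸ r < p
          n∸r<p = subst (n ∸ r <_) (m∸[m∸n]≡n (<⇒≤ p<n))
                    (∸-monoʳ-< (≤-<-trans (M₁.discriminates-nested M p<n D l<q q<p E) m<r) r≤n)
          go : ∀ i → n ∸ r ≡ i → G₂.CollAt (rev n v) r
          go zero    eq = contradiction (subst (suc q <_) eq q<n∸r) λ ()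
          go (suc i) eq = subst (G₂.CollAt (rev n v)) (trans (cong (n ∸_) (sym eq)) (m∸[m∸n]≡n r≤n))
            (subst (λ P → P) (sym (M₂.triple-rev {v = v} G₂.Coll (<-trans i<p p<n)))
              (case to (rec′ (∸-monoʳ-< q<i (<⇒≤ i<p)) refl l<i i<p) (proj₁ (between l<i i<p))
               of λ (a , b) → b , a))
            where
            i<p : suc i < p
            i<p = subst (_< p) eq n∸r<p
            q<i : suc q < suc i
            q<i = subst (suc q <_) eq q<n∸r
            l<i = <-trans l<q q<i
      inside : ∀ i → Q i
      inside = <-rec Q inside-step

  allSame : M₁.Minimal x y n v → AllSame n v
  allSame {n = n} {v} M {k} lt with M₁.classify M lt
  ... | inj₁ (_ , D) = sameCollˡ M (suc k) lt D
  ... | inj₂ (_ , D) = rev-same v lt (sameCollˡ (M₁.minimal-rev M) _ (∸-monoʳ-< z<s (<⇒≤ lt)) D)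

  -- If `connect` ends at a node not adjacent to `d`, the segment followed by `d` discriminates
  -- `v (suc k)` and the edge transfers. The other outcome is harmless alone; `child-transfer` plays
  -- it off against its mirror image.
  edge-transfer : M₁.Minimal x y n v → ∀ {k} → suc k < n →
    G₁.CollAt v (suc k) → v (suc k) G₁.⟶ d →
    v (suc k) G₂.⟶ d ⊎ Σ[ l ∈ ℕ ] l < suc k × v l G₁.↦ d
                         × (∀ {h} → l ≡ suc h → M₁.OK (v h) (v l) d)
  edge-transfer {n = n} {v} {d} M {k} lt c e with M₁.Shortcuts.connect M k lt c e
  ... | l , l<k , between , inj₂ (f , o) = inj₂ (l , l<k , f , o)
  ... | l , l<k , between , inj₁ ¬adj    = inj₁ (go (suc k ∸ l) (m∸n+n≡m (<⇒≤ l<k)))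
    where
    go : ∀ m → m + l ≡ suc k → v (suc k) G₂.⟶ d
    go zero    eq = contradiction (subst (l <_) (sym eq) l<k) (<-irrefl refl)
    go (suc m) refl = into-end (discriminatedFrom M (suc m) lt coll₂ ¬adj
                                 (λ p q → between p (<⇒≤ q)) avoids)
                               z<s e (proj₁ (to (allSame M lt) c))
      where
      coll₂ : ∀ {q} → l < q → q < suc m + l → G₂.CollAt v q
      coll₂ {suc q} p r = to (allSame M (<-trans r lt)) (proj₁ (between p (<⇒≤ r)))
      avoids : ∀ {j} → j ≤ suc m → v (j + l) ≢ d
      avoids {zero}  _  refl with between ≤-refl l<k
      ... | (f , _) , g = G₁.⟶⇒¬↤ g f
      avoids {suc j} le eq = G₁.↦⇒≢ (inj₁ (proj₂ (between (s≤s (m≤n+m l j)) (+-monoˡ-≤ l le)))) eq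

  edge-transferʳ : M₁.Minimal x y n v → ∀ {k} → suc k < n →
    G₁.CollAt v (suc k) → v (suc k) G₁.⟶ d →
    v (suc k) G₂.⟶ d ⊎ Σ[ r ∈ ℕ ] suc k < r × r ≤ n × v r G₁.↦ d
                         × (r < n → M₁.OK d (v r) (v (suc r)))
  edge-transferʳ {n = n} {v} {d} M {k} lt c e = go
    (edge-transfer (M₁.minimal-rev M) p<n
       (subst (G₁.CollAt (rev n v)) (sym eq)
              (subst (λ P → P) (sym (M₁.triple-rev {v = v} G₁.Coll lt)) (proj₂ c , proj₁ c)))
       (subst (G₁._⟶ d) (sym vp) e))
    where
    p : ℕ
    p = n ∸ suc (suc k)
    eq : suc p ≡ n ∸ suc k
    eq = suc[n∸1+m]≡n∸m lt
    vp : rev n v (suc p) ≡ v (suc k)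
    vp = trans (cong (rev n v) eq) (M₁.rev-∸ {v = v} (<⇒≤ lt))
    p<n : suc p < n
    p<n = subst (_< n) (sym eq) (∸-monoʳ-< z<s (<⇒≤ lt))
    k<n∸l : ∀ {l} → l < suc p → suc k < n ∸ l
    k<n∸l {l} l<p = subst (_< n ∸ l) (m∸[m∸n]≡n (<⇒≤ lt))
                      (∸-monoʳ-< (subst (l <_) eq l<p) (m∸n≤m n (suc k)))
    right : ∀ l → l < n → (∀ {h} → l ≡ suc h → M₁.OK (rev n v h) (rev n v l) d) →
            n ∸ l < n → M₁.OK d (v (n ∸ l)) (v (suc (n ∸ l)))
    right zero    _ _ lt′ = contradiction lt′ (<-irrefl refl)
    right (suc h) h<n o _ = M₁.OK-sym (subst (λ a → M₁.OK a (v (n ∸ suc h)) d)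
      (cong v (sym (suc[n∸1+m]≡n∸m (<-trans (n<1+n h) h<n)))) (o refl))
    go : rev n v (suc p) G₂.⟶ d ⊎ Σ[ l ∈ ℕ ] l < suc p × rev n v l G₁.↦ d
           × (∀ {h} → l ≡ suc h → M₁.OK (rev n v h) (rev n v l) d) → _
    go (inj₁ f) = inj₁ (subst (G₂._⟶ d) vp f)
    go (inj₂ (l , l<p , f , o)) =
      inj₂ (n ∸ l , k<n∸l l<p , m∸n≤m n l , f , right l (<-trans l<p p<n) o)

  -- If the walk can turn to `d` on both sides, `v l ↦ d` and `v r ↦ d` replace everything between
  -- `l` and `r`. The new collider `d` is an ancestor of `Z`, and it is closer to `Z` than the
  -- dropped `v (suc k)`, so the walk was not minimal.
  child-transfer : M₁.Minimal x y n v → ∀ {k} → suc k < n → G₁.CollAt v (suc k) →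
    v (suc k) G₁.⟶ d → d ∈ M₁.AncZ → dist d < dist (v (suc k)) → v (suc k) G₂.⟶ d
  child-transfer {n = n} {v} {d} M {k} lt c e a d< with edge-transfer M lt c e | edge-transferʳ M lt c e
  ... | inj₁ g | _      = g
  ... | inj₂ _ | inj₁ g = g
  ... | inj₂ (l , l<k , f , left) | inj₂ (r , k<r , r≤n , g , right) = ⊥-elim
    (no-join (<⇒≤ (<-trans l<k lt))
      (M₁.inner-cons (Adj-sym (↦⇒Adj g))
                     (λ 0<m → right (m∸n≢0⇒n<m λ eq → <-irrefl (sym eq) 0<m)) (suffix r≤n))
      (cong v (m∸n+n≡m r≤n)) (↦⇒Adj f) left
      (λ _ → M₁.OK-in g (λ _ → a) (λ h → contradiction f (⟶⇒¬↤ h)) (λ h → ──⇒¬↤ h f))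
      (<-≤-trans
        (subst (_< M₁.weight l v + (suc (dist (v (suc k))) + M₁.weight (n ∸ r) (λ k → v (k + r))))
               (cong (M₁.weight l v +_) (sym (M₁.weight-cons (n ∸ r) w)))
               (+-monoʳ-< (M₁.weight l v) (+-monoˡ-< _ (s≤s d<))))
        (gap l<k k<r r≤n)))
    where
    open M₁.Shortcuts M using (no-join; suffix; gap)
    open G₁
    w : ℕ → V
    w = join 0 (λ _ → d) (λ k → v (k + r))

  -- Consecutive triples on a shortest directed path to Z are unshielded.
  shortest-transfer : ∀ {u d d′} → u G₁.⟶ d → u G₂.⟶ d → d G₁.⟶ d′ → d′ ∈ M₁.AncZ →
                      dist u ≡ suc (dist d) → dist d ≡ suc (dist d′) → d G₂.⟶ d′
  shortest-transfer {u} {d} {d′} e₁ e₂ f a du dd = go (G₂.markAt (G₂.Adj-sym (adj₁₂ (forward f))))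
    where
    nonadj : ¬ G₁.Adj u d′
    nonadj g = <-irrefl refl (≤-trans (s≤s (≤-reflexive (sym dd)))
                 (subst (_≤ suc (dist d′)) du (dist-step (G₁.⟶-⟶ e₁ f g) a)))
    go : d′ G₂.↦ d ⊎ d G₂.⊸ d′ → d G₂.⟶ d′
    go (inj₁ g) = contradiction (proj₂ (proj₂ (from (sameUnshielded u d d′)
      (((G₂.↦⇒≢ (inj₁ e₂) , (λ { refl → G₁.noSelfLoop (forward f) }) ,
         (λ { refl → G₁.⟶⇒¬↤ e₁ (inj₁ f) })) ,
        backward e₂ , adj₁₂ (forward f) , nonadj ∘ adj₂₁) , inj₁ e₂ , g)))) (G₁.⟶⇒¬↤ f)
    go (inj₂ (inj₁ g)) = g
    go (inj₂ (inj₂ g)) = contradiction (adj₂₁ (forward (G₂.⟶-── e₂ g))) nonadj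

  -- The preceding edge `u ⟶ d` is carried along in both graphs, since it completes the unshielded
  -- triple that transfers the next edge.
  ancestor-transfer : ∀ k {u d} → dist d ≡ k → u G₁.⟶ d → u G₂.⟶ d → d ∈ M₁.AncZ →
                      dist u ≡ suc (dist d) → d ∈ M₂.AncZ
  ancestor-transfer k {u} {d} dk e₁ e₂ a du with child a
  ... | inj₁ d∈Z = d , d∈Z , ε
  ... | inj₂ (d′ , f , a′ , dd) with shortest-transfer e₁ e₂ f a′ du dd | k
  ...   | f₂ | zero  = contradiction (trans (sym dd) dk) λ ()
  ...   | f₂ | suc j with ancestor-transfer j (suc-injective (trans (sym dd) dk)) f f₂ a′ dd
  ...     | z , z∈Z , s = z , z∈Z , f₂ ◅ s

  collider-transfer : M₁.Minimal x y n v → ∀ {k} → suc k < n → G₁.CollAt v (suc k) →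
                      v (suc k) ∈ M₂.AncZ
  collider-transfer M lt c with child (M₁.coll (M₁.ok (M₁.Minimal.inner M) lt) (proj₁ c) (proj₂ c))
  ... | inj₁ ∈Z = _ , ∈Z , ε
  ... | inj₂ (d , e , a , eq) with child-transfer M lt c e a (≤-reflexive (sym eq))
  ...   | f with ancestor-transfer (dist d) refl e f a eq
  ...     | z , z∈Z , s = z , z∈Z , f ◅ s

  Forb₂ : V → V → V → Set ℓ
  Forb₂ a b c = (a G₂.↦ b × b G₂.── c) ⊎ (c G₂.↦ b × b G₂.── a)

  -- In an unshielded triple σ-completeness would make the outer nodes adjacent. On a longer segment
  -- `v (pred p)` is a collider in `H₂` with an edge to `v (suc p)`: it has no undirected edge to
  -- `v p`, and `v p ── v (suc p)` would give `v (pred p) ⟶ v p`.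
  forb-discriminated : M₁.Minimal x y n v → ∀ {p l} → p < n → G₁.Discriminates v p l →
                       ¬ Forb₂ (v (pred p)) (v p) (v (suc p))
  forb-discriminated {v = v} M {p} {l} p<n D = go (p ∸ l) (m∸n+n≡m (<⇒≤ l<p))
    where
    open G₁.Discriminates D
    go : ∀ m → m + l ≡ p → ¬ Forb₂ (v (pred p)) (v p) (v (suc p))
    go zero          refl _               = <-irrefl refl l<p
    go (suc zero)    refl (inj₁ (e , f))  = nonadj (adj₂₁ (G₂.↦⇒Adj (G₂.↦-── e f)))
    go (suc zero)    refl (inj₂ (e , f))  = nonadj (adj₂₁ (G₂.Adj-sym (G₂.↦⇒Adj (G₂.↦-── e f))))
    go (suc (suc m)) refl = λ
      { (inj₁ (e , f)) → G₂.⟶⇒¬↤ (G₂.⟶-── into₂ (G₂.──-sym f)) (proj₂ c₂)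
      ; (inj₂ (e , f)) → G₂.──⇒¬↦ f (proj₂ c₂) }
      where
      coll₂ : ∀ {q} → l < q → q < suc (suc m) + l → G₂.CollAt v q
      coll₂ {suc q} l<q q<p = to (allSame M (<-trans q<p p<n)) (proj₁ (between l<q q<p))
      c₂ : G₂.CollAt v (suc m + l)
      c₂ = coll₂ (s≤s (m≤n+m l m)) ≤-refl
      into₂ : v (suc m + l) G₂.⟶ v (suc (suc (suc m) + l))
      into₂ = into-transfer (discriminated M (suc (suc m)) p<n D coll₂) {suc m} z<s ≤-refl

  no-forb : M₁.Minimal x y n v → ∀ {k} → suc k < n → ¬ Forb₂ (v k) (v (suc k)) (v (suc (suc k)))
  no-forb {n = n} {v} M {k} lt F with M₁.classify M lt
  ... | inj₁ (_ , D) = forb-discriminated M lt D F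
  ... | inj₂ (_ , D) = forb-discriminated (M₁.minimal-rev M) (∸-monoʳ-< z<s (<⇒≤ lt)) D
    (subst (λ P → P) (sym (M₁.triple-rev {v = v} Forb₂ lt)) (swap F))

  openSeq-transfer : M₁.OpenSeq x y n v → Σ[ m ∈ ℕ ] Σ[ w ∈ (ℕ → V) ] M₂.OpenSeq x y m w
  openSeq-transfer O with M₁.minimize O
  ... | n , v , M = n , v , record
    { inner = record { adj = λ lt → adj₁₂ (M₁.adj inner lt) ; ok = ok₂ }
    ; start≡ = start≡ ; end≡ = end≡ ; x∉Z = x∉Z ; y∉Z = y∉Z }
    where
    open M₁.Minimal M
    coll∈Z : ∀ {k} → suc k < n → v (suc k) ∈ Z → G₂.CollAt v (suc k)
    coll∈Z lt ∈Z = to (allSame M lt) (M₁.Shortcuts.∈Z⇒collider M lt ∈Z)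
    ok₂ : ∀ {k} → suc k < n → M₂.OK (v k) (v (suc k)) (v (suc (suc k)))
    ok₂ lt = record
      { coll  = λ p q → collider-transfer M lt (from (allSame M lt) (p , q))
      ; outˡ  = λ e ∈Z → G₂.⊸⇒¬↤ e (proj₁ (coll∈Z lt ∈Z))
      ; outʳ  = λ e ∈Z → G₂.⊸⇒¬↤ e (proj₂ (coll∈Z lt ∈Z))
      ; forbʳ = λ e f → no-forb M lt (inj₁ (e , f))
      ; forbˡ = λ e f → no-forb M lt (inj₂ (e , f)) }

-- Separating two non-adjacent nodes

last-step : {V : Set ℓ} {T : Rel V ℓ′} {a b : V} → Star T a b → a ≡ b ⊎ Σ[ x ∈ V ] T x b
last-step ε = inj₁ refl
last-step (e ◅ s) with last-step s
... | inj₁ refl = inj₂ (_ , e)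
... | inj₂ f    = inj₂ f

module Separator (em : ExcludedMiddle ℓ) {V : Set ℓ} (H : MixedGraph V) (mag : IsσMAG H)
                 (a b : V) where
  private module G = Graph em H mag

  Ends : Pred V ℓ
  Ends = ｛ a ｝ ∪ ｛ b ｝

  -- The second alternative admits only nodes without incoming arrowheads, so that
  -- colliders with descendants in Sep are ancestors of a or b.
  Sep : Pred V ℓ
  Sep z = (a ≢ z × b ≢ z) ×
          (z ∈ AncSet H Ends
           ⊎ (Σ[ c ∈ V ] c ∈ Ends × Star G._⊸_ z c) × ¬ (Σ[ x ∈ V ] x G.↦ z))

  -- With all distances zero, minimal walks are the shortest ones.
  open MinimalWalks em H mag Sep (λ _ → 0)

  -- A directed walk to a node without incoming arrowheads is trivial, so `u` would be that node
  -- itself; both alternatives of the last hypothesis exclude this.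
  ancSep⇒anc : ∀ {u} → u ∈ AncZ → (Σ[ x ∈ V ] x ↦ u) ⊎ u ∉ Sep → u ∈ AncSet H Ends
  ancSep⇒anc (z , (_ , inj₁ (c , c∈ , s′)) , s) _ = c , c∈ , s ◅◅ s′
  ancSep⇒anc (z , z∈@(_ , inj₂ (_ , none)) , s) r with last-step s | r
  ... | inj₂ (x , e) | _           = contradiction (x , inj₁ e) none
  ... | inj₁ refl    | inj₁ into   = contradiction into none
  ... | inj₁ refl    | inj₂ u∉Sep  = contradiction z∈ u∉Sep

  module _ {x y : V} {n : ℕ} {v : ℕ → V} (M : Minimal x y n v) (y∈ : y ∈ Ends) where
    open Shortcuts M

    end∈ : v n ∈ Ends
    end∈ = subst (_∈ Ends) (sym end≡) y∈

    directedʳ : ∀ {i} → i < n → v i ⟶ v (suc i) → v i ∈ AncSet H Ends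
    directedʳ lt e with follow lt ≤-refl e
    ... | inj₁ u = ancSep⇒anc u (inj₂ (tail∉Zʳ lt (inj₁ e)))
    ... | inj₂ s = v n , end∈ , e ◅ s

    undirectedʳ : ∀ m {i} → suc (m + i) ≡ n → v i ── v (suc i) → Σ[ c ∈ V ] c ∈ Ends × Star _⊸_ (v i) c
    undirectedʳ zero    refl e = v n , end∈ , inj₂ e ◅ ε
    undirectedʳ (suc m) {i} eq e = go (markAt (Adj-sym (adj inner i<n)))
      where
      i<n : suc i < n
      i<n = subst (suc i <_) eq (s≤s (s≤s (m≤n+m i m)))
      go : v (suc (suc i)) ↦ v (suc i) ⊎ v (suc i) ⊸ v (suc (suc i)) →
           Σ[ c ∈ V ] c ∈ Ends × Star _⊸_ (v i) c
      go (inj₁ f) = contradiction (──-sym e) (forbˡ (ok inner i<n) f)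
      go (inj₂ (inj₁ f)) with directedʳ i<n f
      ... | c , c∈ , s = c , c∈ , inj₂ e ◅ gmap id inj₁ s
      go (inj₂ (inj₂ f)) with undirectedʳ m (trans (cong suc (+-suc m i)) eq) f
      ... | c , c∈ , s = c , c∈ , inj₂ e ◅ s

  module _ {n : ℕ} {v : ℕ → V} (M : Minimal a b n v) where
    open Shortcuts M

    module _ {k} (lt : suc k < n) where
      private
        u : V
        u = v (suc k)
        k<n : k < n
        k<n = <-trans (n<1+n k) lt

        directedˡ : u ⟶ v k → u ∈ AncSet H Ends
        directedˡ e = subst (_∈ AncSet H Ends) (rev-∸ {v = v} (<⇒≤ lt))
          (directedʳ (minimal-rev M) (inj₁ refl) (∸-monoʳ-< z<s (<⇒≤ lt))
            (subst₂ _⟶_ (sym (rev-∸ {v = v} (<⇒≤ lt))) (sym (rev-suc {v = v} k<n)) e))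

        -- An arrowhead at `u` would make its two neighbours adjacent by σ-completeness.
        -- Ancestrality leaves only an undirected edge, which a minimal walk does not admit.
        no-incoming : u ── v k → u ── v (suc (suc k)) → ¬ (Σ[ x ∈ V ] x ↦ u)
        no-incoming e f (x , g) with σ-complete₂ g e f (distinct (m<n⇒m<1+n ≤-refl) lt ∘ sym)
        ... | forward h    = ancestralWalk (inj₂ (──-sym f) ◅ inj₂ e ◅ ε) (inj₁ h)
        ... | backward h   = ancestralWalk (inj₂ (──-sym e) ◅ inj₂ f ◅ ε) (inj₁ h)
        ... | bidirected h = ancestralWalk (inj₂ (──-sym f) ◅ inj₂ e ◅ ε) (inj₂ h)
        ... | undirected h = Shielded.shielded── lt h

        inside : u ∈ AncSet H Ends ⊎ (Σ[ c ∈ V ] c ∈ Ends × Star _⊸_ u c) × ¬ (Σ[ x ∈ V ] x ↦ u) →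
                 u ∈ Sep
        inside r = ((λ eq → distinct z<s (<⇒≤ lt) (trans start≡ eq)) ,
                    (λ eq → distinct lt ≤-refl (trans (sym eq) (sym end≡)))) , r

      -- A tail at `u` leads along the walk to an end, or to a collider and from there to an end.
      -- This puts `u` into `Sep`, although a non-collider has to avoid it.
      interior : CollAt v (suc k) × u ∈ AncSet H Ends
      interior with markAt (adj inner k<n) | markAt (Adj-sym (adj inner lt))
      ... | inj₁ e | inj₁ f = (e , f) , ancSep⇒anc (coll (ok inner lt) e f) (inj₁ (_ , e))
      ... | inj₂ (inj₁ e) | _ =
        contradiction (inside (inj₁ (directedˡ e))) (outˡ (ok inner lt) (inj₁ e))
      ... | _ | inj₂ (inj₁ f) =
        contradiction (inside (inj₁ (directedʳ M (inj₂ refl) lt f))) (outʳ (ok inner lt) (inj₁ f))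
      ... | inj₁ e | inj₂ (inj₂ f) = contradiction f (forbʳ (ok inner lt) e)
      ... | inj₂ (inj₂ e) | inj₁ f = contradiction e (forbˡ (ok inner lt) f)
      ... | inj₂ (inj₂ e) | inj₂ (inj₂ f) = contradiction
        (inside (inj₂ (undirectedʳ M (inj₂ refl) (n ∸ suc (suc k))
                         (trans (sym (+-suc _ _)) (m∸n+n≡m lt)) f , no-incoming e f)))
        (outˡ (ok inner lt) (inj₂ e))

  separated : a ≢ b → ¬ Adj a b → Separated H ｛ a ｝ ｛ b ｝ Sep
  separated a≢b ¬adj refl refl w o with minimize (Open⇒OpenSeq w o)
  ... | n , v , M = no-inducing n (λ _ → adj inner) distinct (n≢0⇒n>0 (λ n≡0 →
      a≢b (trans (sym start≡) (trans (cong v (sym n≡0)) end≡))))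
      (λ e → ¬adj (subst₂ Adj start≡ end≡ e))
      (λ {k} lt → proj₁ (interior M lt) ,
        subst₂ (λ c d → v (suc k) ∈ AncSet H (｛ c ｝ ∪ ｛ d ｝))
               (sym start≡) (sym end≡) (proj₂ (interior M lt)))
    where open Shortcuts M

-- From equivalence to the three conditions

applyUpTo-++ : {A : Set ℓ} (f : ℕ → A) (n : ℕ) (xs : List A) {b c : A} →
  applyUpTo f n ≡ xs ++ b ∷ c ∷ [] →
  n ≡ suc (suc (List.length xs)) × (∀ {k} → k < List.length xs → f k ∈ₗ xs)
  × f (List.length xs) ≡ b × f (suc (List.length xs)) ≡ c
applyUpTo-++ f (suc (suc zero)) [] refl = refl , (λ ()) , refl , refl
applyUpTo-++ f (suc n) (x ∷ xs) eq with ∷-injective eq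
... | refl , eq′ with applyUpTo-++ (f ∘ suc) n xs eq′
...   | p , q , r , s = cong suc p , (λ { {zero} _ → here refl ; {suc k} (s≤s lt) → there (q lt) }) , r , s

applyUpTo-injective : {A : Set ℓ} (f g : ℕ → A) (m n : ℕ) → applyUpTo f m ≡ applyUpTo g n →
                      m ≡ n × (∀ {k} → k < m → f k ≡ g k)
applyUpTo-injective f g zero    zero    _  = refl , λ ()
applyUpTo-injective f g (suc m) (suc n) eq with ∷-injective eq
... | p , eq′ with applyUpTo-injective (f ∘ suc) (g ∘ suc) m n eq′
...   | q , r = cong suc q , λ { {zero} _ → p ; {suc k} (s≤s lt) → r lt }

module Forward (em : ExcludedMiddle ℓ) {V : Set ℓ} (H₁ H₂ : MixedGraph V)
               (mag₁ : IsσMAG H₁) (mag₂ : IsσMAG H₂)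
               (separated₂₁ : ∀ {X Y Z} → Separated H₂ X Y Z → Separated H₁ X Y Z) where
  module G₁ = Graph em H₁ mag₁
  module G₂ = Graph em H₂ mag₂
  module S₂ = Separator em H₂ mag₂

  adjacent : ∀ {a b} → G₁.Adj a b → G₂.Adj a b
  adjacent {a} {b} e with em {P = G₂.Adj a b}
  ... | yes f  = f
  ... | no ¬f = ⊥-elim (separated₂₁ (S₂.separated a b a≢b ¬f) refl refl (e ◅ ε)
      (Seq.Inner⇒Open (e ◅ ε)
        (record { adj = λ { {zero} _ → e ; {suc _} (s≤s ()) } ; ok = λ { (s≤s ()) } })
        (λ z → proj₁ (proj₁ z) refl) (λ z → proj₂ (proj₁ z) refl)))
    where
    module Seq = Sequences em H₁ mag₁ (S₂.Sep a b)
    a≢b : a ≢ b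
    a≢b refl = G₁.noSelfLoop e

  -- Unshielded colliders are the case `m = 0`, discriminated ones the case `m > 0`. If the last
  -- inner node were a non-collider in `H₂`, it would belong to the separator like the other inner
  -- nodes; these are all colliders in `H₁`, so the path would be open there.
  collider-last : ∀ m (v : ℕ → V) → let N = suc (suc m) in
    (∀ {k} → k < N → G₁.Adj (v k) (v (suc k))) →
    (∀ {j k} → j < k → k ≤ N → v j ≢ v k) → ¬ G₂.Adj (v 0) (v N) →
    (∀ {k} → k < m → G₂.CollAt v (suc k) × v (suc k) G₂.⟶ v N) →
    (∀ {k} → k ≤ m → G₁.CollAt v (suc k)) → G₂.CollAt v (suc m)
  collider-last m v adj distinct ¬adj coll₂ coll₁ with em {P = G₂.CollAt v (suc m)}
  ... | yes c = c
  ... | no ¬c = ⊥-elim (case Seq.OpenSeq⇒Open open-seq of λ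
      (w , o) → separated₂₁ (S₂.separated (v 0) (v N) (distinct z<s ≤-refl) ¬adj) refl refl w o)
    where
    N = suc (suc m)
    b = v (suc m)
    open S₂ (v 0) (v N) using (Sep; Ends)
    module Seq = Sequences em H₁ mag₁ Sep
    Inside : V → Set ℓ
    Inside z = z ∈ AncSet H₂ Ends
               ⊎ (Σ[ c ∈ V ] c ∈ Ends × Star G₂._⊸_ z c) × ¬ (Σ[ x ∈ V ] x G₂.↦ z)
    directed : b G₂.⟶ v m → Inside b
    directed e = go m refl
      where
      go : ∀ j → j ≡ m → Inside b
      go zero    refl = inj₁ (v 0 , inj₁ refl , e ◅ ε)
      go (suc j) refl = inj₁ (v N , inj₂ refl , e ◅ proj₂ (coll₂ ≤-refl) ◅ ε)
    into-undirected : v m G₂.↦ b → ¬ b G₂.── v N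
    into-undirected e f = go m refl
      where
      go : ∀ j → j ≡ m → ⊥
      go zero    refl = ¬adj (G₂.↦⇒Adj (G₂.↦-── e f))
      go (suc j) refl = G₂.⟶⇒¬↤ (G₂.⟶-── (proj₂ (coll₂ ≤-refl)) (G₂.──-sym f))
                                 (proj₂ (proj₁ (coll₂ ≤-refl)))
    undirected-case : b G₂.── v m → v N G₂.↦ b ⊎ b G₂.── v N → Inside b
    undirected-case e = go m refl
      where
      go : ∀ j → j ≡ m → v N G₂.↦ b ⊎ b G₂.── v N → Inside b
      go (suc j) refl _        = contradiction (proj₂ (proj₁ (coll₂ ≤-refl))) (G₂.──⇒¬↦ e)
      go zero    refl (inj₁ g) = contradiction (G₂.Adj-sym (G₂.↦⇒Adj (G₂.↦-── g e))) ¬adj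
      go zero    refl (inj₂ g) = inj₂ ((v N , inj₂ refl , inj₂ g ◅ ε) ,
                           λ (x , h) → ¬adj (G₂.σ-complete₂ h e g (distinct z<s ≤-refl ∘ sym)))
    last : Inside b
    last with G₂.markAt (adjacent (adj {m} (m<n⇒m<1+n ≤-refl)))
            | G₂.markAt (G₂.Adj-sym (adjacent (adj {suc m} ≤-refl)))
    ... | inj₁ e        | inj₁ f        = contradiction (e , f) ¬c
    ... | _             | inj₂ (inj₁ f) = inj₁ (v N , inj₂ refl , f ◅ ε)
    ... | inj₁ e        | inj₂ (inj₂ f) = contradiction f (into-undirected e)
    ... | inj₂ (inj₁ e) | _             = directed e
    ... | inj₂ (inj₂ e) | inj₁ f        = undirected-case e (inj₁ f)
    ... | inj₂ (inj₂ e) | inj₂ (inj₂ f) = undirected-case e (inj₂ f)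
    inside : ∀ {k} → k ≤ m → Inside (v (suc k))
    inside k≤m with m≤n⇒m<n∨m≡n k≤m
    ... | inj₁ lt   = inj₁ (v N , inj₂ refl , proj₂ (coll₂ lt) ◅ ε)
    ... | inj₂ refl = last
    open-seq : Seq.OpenSeq (v 0) (v N) N v
    open-seq = record
      { inner = record
        { adj = adj
        ; ok = λ {k} lt → let k≤m = s≤s⁻¹ (s≤s⁻¹ lt) ; (e , f) = coll₁ k≤m in
            Seq.OK-in f
                      (λ _ → v (suc k) , ((distinct z<s (<⇒≤ lt) , distinct lt ≤-refl ∘ sym) , inside k≤m) , ε)
                      (λ g → contradiction e (G₁.⟶⇒¬↤ g)) (λ g → G₁.──⇒¬↤ g e) }
      ; start≡ = refl ; end≡ = refl
      ; x∉Z = λ z → proj₁ (proj₁ z) refl ; y∉Z = λ z → proj₂ (proj₁ z) refl }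

  unshieldedCollider : ∀ {a b c} → UnshieldedCollider H₁ a b c → ¬ G₂.Adj a c →
                       UnshieldedCollider H₂ a b c
  unshieldedCollider {a} {b} {c} (((a≢b , b≢c , a≢c) , e , f , _) , coll₁) ¬adj =
    ((a≢b , b≢c , a≢c) , adjacent e , adjacent f , ¬adj) ,
    collider-last 0 v
      (λ { {0} _ → G₁.Adj-sym e ; {1} _ → f ; {suc (suc _)} (s≤s (s≤s ())) })
      (λ { {0} {1} _ _ → a≢b ; {0} {2} _ _ → a≢c ; {1} {2} _ _ → b≢c ; {suc _} {1} (s≤s ()) _
         ; {suc (suc _)} {2} (s≤s (s≤s ())) _ ; {_} {suc (suc (suc _))} _ (s≤s (s≤s ())) })
      ¬adj (λ ()) (λ { {0} _ → coll₁ })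
    where
    v : ℕ → V
    v 0 = a
    v 1 = b
    v _ = c

  discriminatedCollider : ∀ {a c} (π : Walk H₁ a c) (π′ : Walk H₂ a c) → nodes π ≡ nodes π′ →
    ∀ {b} → Discriminating H₁ π b → Discriminating H₂ π′ b → ColliderOn H₁ π b → ColliderOn H₂ π′ b
  discriminatedCollider {a} {c} π π′ π≡π′ {b} (path , _ , x , xs , shape , between)
                        (path′ , ¬adj , x′ , xs′ , shape′ , between′) π-coll =
    subst (ColliderOn H₂ π′) (proj₁ (proj₂ (proj₂ pos′)))
      (G₂.Coll⇒ColliderOn π′ (subst (suc m <_) (sym len′) ≤-refl)
        (collider-last m v
          (λ {k} lt → adjacent₁ (subst (k <_) (sym len′) lt))
          (λ {j} {k} lt le → path⇒distinct π′ path′ lt (subst (k ≤_) (sym len′) le))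
          (λ e → ¬adj (subst (G₂.Adj a) vN≡c e))
          coll₂ coll₁))
    where
    v = at π′
    same = applyUpTo-injective (at π) v (suc (length π)) (suc (length π′))
             (trans (sym (nodes-at π)) (trans π≡π′ (nodes-at π′)))
    pos  = applyUpTo-++ (at π ∘ suc) (length π) (x ∷ xs)
             (proj₂ (∷-injective (trans (sym (nodes-at π)) shape)))
    pos′ = applyUpTo-++ (v ∘ suc) (length π′) (x′ ∷ xs′)
             (proj₂ (∷-injective (trans (sym (nodes-at π′)) shape′)))
    m = List.length (x′ ∷ xs′)
    len′ : length π′ ≡ suc (suc m)
    len′ = proj₁ pos′
    len : length π ≡ suc (suc m)
    len = trans (suc-injective (proj₁ same)) len′
    m≡ : List.length (x ∷ xs) ≡ m
    m≡ = suc-injective (suc-injective (trans (sym (proj₁ pos)) len))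
    vN≡c : v (suc (suc m)) ≡ c
    vN≡c = trans (cong v (sym len′)) (at-length π′)
    at≡ : ∀ {k} → k ≤ suc (suc m) → at π k ≡ v k
    at≡ {k} le = proj₂ same (s≤s (subst (k ≤_) (sym len) le))
    adjacent₁ : ∀ {k} → k < length π′ → G₁.Adj (v k) (v (suc k))
    adjacent₁ {k} lt = subst₂ G₁.Adj (at≡ (<⇒≤ lt′)) (at≡ lt′)
                         (step-at π (subst (k <_) (sym len) lt′))
      where lt′ = subst (k <_) len′ lt
    coll₂ : ∀ {k} → k < m → G₂.CollAt v (suc k) × v (suc k) G₂.⟶ v (suc (suc m))
    coll₂ {k} lt with between′ (proj₁ (proj₂ pos′) lt)
    ... | c₂ , e = G₂.path-CollAt π′ path′ (subst (suc k <_) (sym len′) (s≤s (m<n⇒m<1+n lt))) c₂ ,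
                   subst (v (suc k) G₂.⟶_) (sym vN≡c) e
    on-π : ∀ {k} → k ≤ m → ColliderOn H₁ π (at π (suc k))
    on-π {k} le with m≤n⇒m<n∨m≡n le
    ... | inj₁ lt   = proj₁ (between (proj₁ (proj₂ pos) (subst (k <_) (sym m≡) lt)))
    ... | inj₂ refl = subst (ColliderOn H₁ π)
      (trans (sym (proj₁ (proj₂ (proj₂ pos)))) (cong (at π ∘ suc) m≡)) π-coll
    coll₁ : ∀ {k} → k ≤ m → G₁.CollAt v (suc k)
    coll₁ {k} le = subst (λ P → P)
      (trans (cong₂ (λ a b → G₁.Coll a b (at π (suc (suc k))))
                    (at≡ (m≤n⇒m≤1+n (m≤n⇒m≤1+n le))) (at≡ (m≤n⇒m≤1+n (s≤s le))))
             (cong (G₁.Coll (v k) (v (suc k))) (at≡ (s≤s (s≤s le)))))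
      (G₁.path-CollAt π path (subst (suc k <_) (sym len) (s≤s (s≤s le))) (on-π le))

-- Both implications, symmetrized in the two graphs

module _ (em : ExcludedMiddle ℓ) {V : Set ℓ} where
  open Equivalence

  equivalent⇒conditions : (H₁ H₂ : MixedGraph V) → IsσMAG H₁ → IsσMAG H₂ → MarkovEquivalent H₁ H₂ →
    SameAdjacencies H₁ H₂ × SameUnshieldedColliders H₁ H₂ × SameDiscriminatedColliders H₁ H₂
  equivalent⇒conditions H₁ H₂ mag₁ mag₂ eq =
    (λ _ _ → mk⇔ F₁₂.adjacent F₂₁.adjacent) ,
    (λ _ _ _ → mk⇔ (λ u → F₁₂.unshieldedCollider u (proj₂ (proj₂ (proj₂ (proj₁ u))) ∘ F₂₁.adjacent))
                   (λ u → F₂₁.unshieldedCollider u (proj₂ (proj₂ (proj₂ (proj₁ u))) ∘ F₁₂.adjacent))) ,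
    (λ π π′ π≡π′ _ d d′ → mk⇔ (F₁₂.discriminatedCollider π π′ π≡π′ d d′)
                              (F₂₁.discriminatedCollider π′ π (sym π≡π′) d′ d))
    where
    module F₁₂ = Forward em H₁ H₂ mag₁ mag₂ (λ {X} {Y} {Z} → from (eq X Y Z))
    module F₂₁ = Forward em H₂ H₁ mag₂ mag₁ (λ {X} {Y} {Z} → to (eq X Y Z))

  conditions⇒separated : (H₁ H₂ : MixedGraph V) → IsσMAG H₁ → IsσMAG H₂ →
    SameAdjacencies H₁ H₂ → SameUnshieldedColliders H₁ H₂ → SameDiscriminatedColliders H₁ H₂ →
    ∀ {X Y Z} → Separated H₂ X Y Z → Separated H₁ X Y Z
  conditions⇒separated H₁ H₂ mag₁ mag₂ adj unsh disc {Z = Z} sep x∈X y∈Y w o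
    with Backward.openSeq-transfer em H₁ H₂ mag₁ mag₂ adj unsh disc Z
           (Sequences.Open⇒OpenSeq em H₁ mag₁ Z w o)
  ... | _ , _ , O with Sequences.OpenSeq⇒Open em H₂ mag₂ Z O
  ...   | w′ , o′ = sep x∈X y∈Y w′ o′

theorem3 : ∀ {ℓ} → ExcludedMiddle ℓ →
    (V : Set ℓ) (H₁ H₂ : MixedGraph V) → IsσMAG H₁ → IsσMAG H₂ →
    MarkovEquivalent H₁ H₂ ⇔
    (SameAdjacencies H₁ H₂
    × SameUnshieldedColliders H₁ H₂
    × SameDiscriminatedColliders H₁ H₂)
theorem3 em V H₁ H₂ mag₁ mag₂ = mk⇔ (equivalent⇒conditions em H₁ H₂ mag₁ mag₂)
  λ (adj , unsh , disc) X Y Z → mk⇔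
    (conditions⇒separated em H₂ H₁ mag₂ mag₁ (λ a b → ⇔-sym (adj a b)) (λ a b c → ⇔-sym (unsh a b c))
      (λ π π′ eq v d d′ → ⇔-sym (disc π′ π (sym eq) v d′ d)))
    (conditions⇒separated em H₁ H₂ mag₁ mag₂ adj unsh disc)
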